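{- Let $p$ be an odd prime, $d\geq 2$ a divisor of $p-1$, $m=(p-1)/d$, and $1\le k\le d$. For each divisor $e$ of $\gcd(d,k)$ let $\mathcal{T}_e(d,k)$ be any transversal (a set containing exactly one element of each orbit) of the $\mathbb{Z}/d\mathbb{Z}$-orbits in $M_e(d,k)$. Then the $k$-th Viète coefficient of the degree-$d$ Gauss period polynomial is \[ a_k(p,d)=\sum_{e\mid \gcd(d,k)}\frac{1}{e}\Big[p\Big(\sum_{S\in\mathcal{T}_e(d,k)} z(S)\Big)-\#\mathcal{T}_e(d,k)\cdot m^{k-1}\Big]. \]
   Context: Fix a primitive root $g$ modulo $p$. For $s\in\mathbb{Z}$ (taken mod $d$) let $C_s=\{g^{jd+s}: j=0,\dots,m-1\}\subset\mathbb{F}_p^*$, so $\mathbf{F}_p^*=C_0\sqcup\cdots\sqcup C_{d-1}$. Let $\zeta$ be a primitive complex $p$-th root of unity and $\eta_j=\sum_{x\in C_j}\zeta^x$ ($j=0,\dots,d-1$), the Gauss $d$-periods. Define $a_k(p,d)$ by $\prod_{j=0}^{d-1}(X-\eta_j)=X^d+\sum_{k=1}^d(-1)^k a_k(p,d)X^{d-k}$, i.e. $a_k(p,d)$ is the $k$-th elementary symmetric function of $\eta_0,\dots,\eta_{d-1}$. Gauss symbol: for nonempty $M_1,\dots,M_n\subseteq\mathbf{F}_p$, $\{M_1,\dots,M_n\}=\#\{(x_1,\dots,x_n)\in M_1\times\cdots\times M_n: x_1+\cdots+x_n=0\}$. For a $k$-subset $S=\{s_1<\dots<s_k\}$ of $\{0,1,\dots,d-1\}$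 put $z(S)=\{\{g^{s_1}\},C_{s_2},\dots,C_{s_k}\}$. Identify $k$-subsets of $\{0,\dots,d-1\}$ with $k$-subsets of $\mathbb{Z}/d\mathbb{Z}$; let $M(d,k)$ be the set of these, with $\mathbb{Z}/d\mathbb{Z}$ acting by translation $\nu\cdot S=\{s+\nu \bmod d: s\in S\}$. For $e\mid\gcd(d,k)$, $M_e(d,k)$ is the set of $S\in M(d,k)$ whose stabilizer in $\mathbb{Z}/d\mathbb{Z}$ has order $e$. -}

module Defs where

infixl 7 _mod_

open import Data.Bool using (Bool; true; false; if_then_else_)
import Data.Bool as Bool
open import Data.Nat as ℕ using (ℕ; zero; suc; _+_; _*_; _∸_; _^_; _%_; _≤_; _<_)
import Data.Nat.Properties as ℕP
open import Data.Nat.Divisibility using (_∣_; _∣?_)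
open import Data.Nat.GCD using (gcd)
open import Data.Integer as ℤ using (ℤ; +_)
open import Data.Rational as ℚ using (ℚ; 0ℚ)
open import Data.List as List using (List; []; _∷_; map; concatMap; filter; length; upTo; _++_)
open import Data.Vec as Vec using (Vec; []; _∷_; last; init)
open import Data.Vec.Properties using (≡-dec)
open import Data.Fin using (Fin)
open import Data.Fin.Subset using (Subset; ∣_∣)
open import Data.Product using (∃; _×_)
open import Relation.Binary.PropositionalEquality using (_≡_)
open import Relation.Nullary using (Dec)
open import Relation.Binary.Definitions using (DecidableEquality)
open import Data.Fin.Properties using (any?)
open import Data.List.Membership.Propositional using (_∈_)
open import Function using (_∘_)
open import Data.Nat.ListAction using (sum)

-- Residues of 𝔽_p are represented by natural numbers taken mod p.
-- (total version of _%_; only used with p prime, hence p ≠ 0)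
_mod_ : ℕ → ℕ → ℕ
x mod zero    = x
x mod (suc n) = x % suc n

IsPrimitiveRoot : ℕ → ℕ → Set
IsPrimitiveRoot p g = ∀ a → 1 ≤ a → a < p → ∃ λ i → (g ^ i) mod p ≡ a

cls : (p g d m s : ℕ) → List ℕ
cls p g d m s = map (λ j → (g ^ (j * d + s)) mod p) (upTo m)

allSums : List (List ℕ) → List ℕ
allSums []       = 0 ∷ []
allSums (M ∷ Ms) = concatMap (λ x → map (λ y → x + y) (allSums Ms)) M

gaussSymbol : ℕ → List (List ℕ) → ℕ
gaussSymbol p Ms = length (filter (λ x → (x mod p) ℕ.≟ 0) (allSums Ms))

elems : ∀ {n} → Subset n → List ℕ
elems []             = []
elems (true ∷ S)  = 0 ∷ map suc (elems S)
elems (false ∷ S) = map suc (elems S)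

zS : (p g d m : ℕ) → Subset d → ℕ
zS p g d m S with elems S
... | []      = 0   -- never used (S is nonempty since k ≥ 1)
... | s ∷ ss  = gaussSymbol p (((g ^ s) mod p ∷ []) ∷ map (cls p g d m) ss)

shift1 : ∀ {n} → Subset n → Subset n
shift1 {zero}  S = S
shift1 {suc n} S = last S ∷ init S

translate : ∀ {d} → Fin d → Subset d → Subset d
translate ν S = go (Data.Fin.toℕ ν) S
  where
  go : ℕ → _ → _
  go zero    T = T
  go (suc i) T = shift1 (go i T)

_≟S_ : ∀ {d} → DecidableEquality (Subset d)
_≟S_ = ≡-dec Bool._≟_

stabOrder : ∀ {d} → Subset d → ℕ
stabOrder {d} S = length (filter (λ ν → translate ν S ≟S S) (List.allFin d))

InM : (d k e : ℕ) → Subset d → Set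
InM d k e S = (∣ S ∣ ≡ k) × (stabOrder S ≡ e)

SameOrbit : ∀ {d} → Subset d → Subset d → Set
SameOrbit {d} S T = ∃ λ (ν : Fin d) → translate ν S ≡ T

sameOrbit? : ∀ {d} (S T : Subset d) → Dec (SameOrbit S T)
sameOrbit? S T = any? (λ ν → translate ν S ≟S T)

IsTransversal : (d k e : ℕ) → List (Subset d) → Set
IsTransversal d k e T =
  (∀ S → S ∈ T → InM d k e S) ×
  (∀ S → InM d k e S → length (filter (sameOrbit? S) T) ≡ 1)

-- ℤ[ζ] ≅ ℤ[x]/(1 + x + … + x^{p-1}).  An element with nonnegative coefficients
-- Σ_r c_r ζ^r is represented by a list of exponents (a formal sum of powers of ζ).

mulF : List ℕ → List ℕ → List ℕ
mulF a b = concatMap (λ x → map (λ y → x + y) b) a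

esym : ℕ → List (List ℕ) → List ℕ
esym zero    _        = 0 ∷ []
esym (suc k) []       = []
esym (suc k) (x ∷ xs) = mulF x (esym k xs) ++ esym (suc k) xs

coeff : ℕ → List ℕ → ℕ → ℕ
coeff p E r = length (filter (λ x → (x mod p) ℕ.≟ r) E)

periods : (p g d m : ℕ) → List (List ℕ)
periods p g d m = map (cls p g d m) (upTo d)

akFormal : (p g d m k : ℕ) → List ℕ
akFormal p g d m k = esym k (periods p g d m)

-- the formal sum E ∈ ℕ[ζ] has value equal to the rational q (in ℚ(ζ)):
-- Σ_r coeff_r ζ^r = q  iff  coeff_r - c = q·[r = 0] for some constant c.
HasValue : ℕ → List ℕ → ℚ → Set
HasValue p E q = ∃ λ (c : ℤ) → ∀ r → r < p →
  ((+ coeff p E r ℤ.- c) ℚ./ 1) ≡ (if r ℕ.≡ᵇ 0 then q else 0ℚ)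

rhsTerm : (p g d m k : ℕ) → (ℕ → List (Subset d)) → ℕ → ℚ
rhsTerm p g d m k T i with suc i ∣? gcd d k
... | Relation.Nullary.yes _ =
      ((+ (p * sum (map (zS p g d m) (T (suc i))))) ℤ.- (+ (length (T (suc i)) * m ^ (k ∸ 1)))) ℚ./ suc i
... | Relation.Nullary.no _  = 0ℚ

rhs : (p g d m k : ℕ) → (ℕ → List (Subset d)) → ℚ
rhs p g d m k T = List.foldr ℚ._+_ 0ℚ (map (rhsTerm p g d m k T) (upTo d))

{-# OPTIONS --safe #-}

-- For a k-subset S let N_S(r) be the number of tuples in the product of the classes C_s (s ∈ S)
-- with sum r.  The coefficient of ζ^r in a_k is N(r) = Σ_S N_S(r), and multiplication by g turns
-- N_S(r) into N_{S+1}(gr), so N takes one value c on the nonzero residues.  Hence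
-- N(0) + (p − 1) c = #M(d,k) mᵏ, while multiplication by powers of g^d gives N_S(0) = m z(S).
-- Eliminating c yields d a_k = p Σ_S z(S) − #M(d,k) m^(k−1).  Since z is constant on orbits and
-- an orbit in M_e(d,k) has d/e elements, grouping the subsets by orbits gives the formula.
module Submission where

open import Defs
open import Data.Bool using (Bool; true; false; if_then_else_)
open import Data.Nat using (ℕ; zero; suc; pred; _+_; _≤_; _<_; _∸_; _*_; _^_; _%_; _/_; _≡ᵇ_; s≤s; z≤n; NonZero; >-nonZero)
import Data.Nat.Properties as ℕ
open import Data.Nat.DivMod using (m%n<n; m≡m%n+[m/n]*n; m%n%n≡m%n; %-distribˡ-+; %-distribˡ-*; m<n⇒m%n≡m; [m+kn]%n≡m%n)
open import Data.Nat.Divisibility using (_∣_; _∣?_; divides; quotient; ∣-refl; ∣-trans; ∣⇒≤)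
open import Data.Nat.GCD using (gcd; gcd[m,n]∣m; gcd-greatest)
open import Data.Nat.ListAction using (sum)
open import Data.Nat.ListAction.Properties using (sum-++)
open import Data.Nat.Primality using (Prime; ¬prime[0]; ¬prime[1])
open import Data.Nat.Tactic.RingSolver using (solve-∀)
import Data.Integer as ℤ
import Data.Integer.Properties as ℤ
open import Data.Integer.Tactic.RingSolver renaming (solve-∀ to ℤ-solve-∀)
open import Data.Rational as ℚ using (0ℚ)
import Data.Rational.Properties as ℚ
open import Data.Rational.Unnormalised using (mkℚᵘ; *≡*)
import Data.Rational.Unnormalised.Properties as ℚᵘ
open import Data.Fin using (Fin; toℕ; fromℕ<)
open import Data.Fin.Properties using (pigeonhole; injective⇒≤; toℕ-fromℕ<; fromℕ<-injective; toℕ<n; toℕ-injective)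
open import Data.Fin.Subset using (Subset; ∣_∣)
open import Data.List using (List; []; _∷_; _++_; _∷ʳ_; map; concatMap; filter; foldr; length; upTo; allFin; tabulate; reverse)
import Data.List.Properties as List
open import Data.List.Membership.Propositional using (_∈_)
open import Data.List.Membership.Propositional.Properties using (∈-map⁻; ∈-++⁻; ∈-upTo⁻)
open import Data.List.Relation.Unary.Any using (here; there)
open import Data.List.Relation.Binary.Pointwise using (Pointwise; []; _∷_)
import Data.Vec as Vec
open Vec using ([]; _∷_; toList; initLast)
import Data.Vec.Properties as Vec
open import Data.Product using (∃; _,_; _×_; proj₁; proj₂)
open import Data.Sum using (inj₁; inj₂)
open import Algebra.Properties.CommutativeSemigroup ℕ.+-commutativeSemigroup using () renaming (interchange to +-interchange; x∙yz≈y∙xz to +-xyz≈yxz)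
open import Algebra.Properties.CommutativeSemigroup ℕ.*-commutativeSemigroup using () renaming (x∙yz≈y∙xz to *-xyz≈yxz)
open import Function using (_∘_; id)
open import Relation.Binary.PropositionalEquality
open import Relation.Nullary using (¬_; Dec; yes; no; contradiction)
open import Relation.Unary using (Pred; Decidable)
open ≡-Reasoning

-- Formal sums are lists, and reordering the factors of a product or multiplying by `g` changes the
-- list. Comparisons are therefore made by summing test functions: arbitrary ones express equality
-- of multisets, those periodic modulo `p` express equality of multisets in 𝔽_p. That the classes
-- are permuted cyclically by `g` rests on g^(p-1) = 1, which is derived from the primitive root
-- property by counting. Orbit invariance of z is not visible from its definition: the fixed element
-- is taken from the class of least index, and a shift may change which class that is. It is read
-- off N_S(0) = m z(S) by cancelling m. Orbits are never formed as sets. Over all strata together,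
-- the orbit of S contains exactly one chosen representative; inserting this 1 into a sum over S and
-- interchanging sums gives each representative the weight d/e. These weights are natural numbers,
-- so the grouping takes place in ℕ and the fractions 1/e are met only when the right-hand side is
-- brought to the common denominator d.

private
  variable
    A B : Set
    P Q : Set

-- Indicators and finite sums over lists.

⟦_⟧ : Dec P → ℕ
⟦ yes _ ⟧ = 1
⟦ no  _ ⟧ = 0

⟦⟧-yes : (P? : Dec P) → P → ⟦ P? ⟧ ≡ 1
⟦⟧-yes (yes _) _ = refl
⟦⟧-yes (no ¬p) p = contradiction p ¬p

⟦⟧-no : (P? : Dec P) → ¬ P → ⟦ P? ⟧ ≡ 0
⟦⟧-no (yes p) ¬p = contradiction p ¬p
⟦⟧-no (no _)  _  = refl

⟦⟧-cong : (P? : Dec P) (Q? : Dec Q) → (P → Q) → (Q → P) → ⟦ P? ⟧ ≡ ⟦ Q? ⟧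
⟦⟧-cong (yes p) Q? to from = sym (⟦⟧-yes Q? (to p))
⟦⟧-cong (no ¬p) Q? to from = sym (⟦⟧-no Q? (¬p ∘ from))

∑ : List A → (A → ℕ) → ℕ
∑ xs f = sum (map f xs)

infix 5 ∑
syntax ∑ xs (λ x → e) = ∑[ x ∈ xs ] e

∑-cong-∈ : (xs : List A) {f g : A → ℕ} → (∀ x → x ∈ xs → f x ≡ g x) → ∑ xs f ≡ ∑ xs g
∑-cong-∈ []       f≗g = refl
∑-cong-∈ (x ∷ xs) f≗g = cong₂ _+_ (f≗g x (here refl)) (∑-cong-∈ xs (λ y y∈xs → f≗g y (there y∈xs)))

∑-cong : (xs : List A) {f g : A → ℕ} → (∀ x → f x ≡ g x) → ∑ xs f ≡ ∑ xs g
∑-cong xs f≗g = ∑-cong-∈ xs (λ x _ → f≗g x)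

∑-++ : (xs ys : List A) (f : A → ℕ) → ∑ (xs ++ ys) f ≡ ∑ xs f + ∑ ys f
∑-++ xs ys f = trans (cong sum (List.map-++ f xs ys)) (sum-++ (map f xs) (map f ys))

∑-map : (h : A → B) (xs : List A) (f : B → ℕ) → ∑ (map h xs) f ≡ ∑ xs (f ∘ h)
∑-map h xs f = cong sum (sym (List.map-∘ xs))

∑-concatMap : (h : A → List B) (xs : List A) (f : B → ℕ) →
              ∑ (concatMap h xs) f ≡ ∑[ x ∈ xs ] ∑ (h x) f
∑-concatMap h []       f = refl
∑-concatMap h (x ∷ xs) f =
  trans (∑-++ (h x) (concatMap h xs) f) (cong (∑ (h x) f +_) (∑-concatMap h xs f))

∑-const : (xs : List A) (c : ℕ) → ∑[ x ∈ xs ] c ≡ length xs * c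
∑-const []       c = refl
∑-const (_ ∷ xs) c = cong (c +_) (∑-const xs c)

∑-zero : (xs : List A) {f : A → ℕ} → (∀ x → x ∈ xs → f x ≡ 0) → ∑ xs f ≡ 0
∑-zero xs f≗0 = trans (∑-cong-∈ xs f≗0) (trans (∑-const xs 0) (ℕ.*-zeroʳ (length xs)))

∑-+ : (xs : List A) (f g : A → ℕ) → ∑[ x ∈ xs ] (f x + g x) ≡ ∑ xs f + ∑ xs g
∑-+ []       f g = refl
∑-+ (x ∷ xs) f g =
  trans (cong (f x + g x +_) (∑-+ xs f g)) (+-interchange (f x) (g x) (∑ xs f) (∑ xs g))

∑-*ˡ : (xs : List A) (c : ℕ) (f : A → ℕ) → ∑[ x ∈ xs ] (c * f x) ≡ c * ∑ xs f
∑-*ˡ []       c f = sym (ℕ.*-zeroʳ c)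
∑-*ˡ (x ∷ xs) c f =
  trans (cong (c * f x +_) (∑-*ˡ xs c f)) (sym (ℕ.*-distribˡ-+ c (f x) (∑ xs f)))

∑-*ʳ : (xs : List A) (c : ℕ) (f : A → ℕ) → ∑[ x ∈ xs ] (f x * c) ≡ ∑ xs f * c
∑-*ʳ xs c f = begin
  ∑[ x ∈ xs ] (f x * c) ≡⟨ ∑-cong xs (λ x → ℕ.*-comm (f x) c) ⟩
  ∑[ x ∈ xs ] (c * f x) ≡⟨ ∑-*ˡ xs c f ⟩
  c * ∑ xs f            ≡⟨ ℕ.*-comm c _ ⟩
  ∑ xs f * c            ∎

∑-swap : (xs : List A) (ys : List B) (f : A → B → ℕ) →
         ∑[ x ∈ xs ] ∑[ y ∈ ys ] f x y ≡ ∑[ y ∈ ys ] ∑[ x ∈ xs ] f x y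
∑-swap []       ys f = sym (∑-zero ys (λ _ _ → refl))
∑-swap (x ∷ xs) ys f =
  trans (cong (∑ ys (f x) +_) (∑-swap xs ys f)) (sym (∑-+ ys (f x) (λ y → ∑[ x ∈ xs ] f x y)))

-- Turns the counts behind `stabOrder`, `coeff`, `gaussSymbol` and the transversal condition into
-- sums of indicators, to which `∑-swap` applies.
length-filter : {P : Pred A _} (P? : Decidable P) (xs : List A) →
                length (filter P? xs) ≡ ∑[ x ∈ xs ] ⟦ P? x ⟧
length-filter P? []       = refl
length-filter P? (x ∷ xs) with P? x
... | yes _ = cong suc (length-filter P? xs)
... | no  _ = length-filter P? xs

∑-upTo-suc : (n : ℕ) (f : ℕ → ℕ) → ∑ (upTo (suc n)) f ≡ f 0 + ∑ (upTo n) (f ∘ suc)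
∑-upTo-suc n f =
  cong (λ l → f 0 + sum l) (trans (List.map-applyUpTo suc f n) (sym (List.map-upTo (f ∘ suc) n)))

∑-upTo-last : (n : ℕ) (f : ℕ → ℕ) → ∑ (upTo (suc n)) f ≡ ∑ (upTo n) f + f n
∑-upTo-last n f = begin
  ∑ (upTo (suc n)) f      ≡⟨ cong (λ l → ∑ l f) (List.upTo-∷ʳ n) ⟨
  ∑ (upTo n ∷ʳ n) f       ≡⟨ ∑-++ (upTo n) (n ∷ []) f ⟩
  ∑ (upTo n) f + (f n + 0) ≡⟨ cong (∑ (upTo n) f +_) (ℕ.+-identityʳ (f n)) ⟩
  ∑ (upTo n) f + f n      ∎

-- Both sums arise from the one over `upTo (suc n)` by dropping one of its two ends, and the end
-- terms agree.
∑-upTo-rotate : (n : ℕ) (f : ℕ → ℕ) → f n ≡ f 0 → ∑ (upTo n) (f ∘ suc) ≡ ∑ (upTo n) f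
∑-upTo-rotate n f fn≡f0 = ℕ.+-cancelˡ-≡ (f 0) _ _ (begin
  f 0 + ∑ (upTo n) (f ∘ suc) ≡⟨ ∑-upTo-suc n f ⟨
  ∑ (upTo (suc n)) f         ≡⟨ ∑-upTo-last n f ⟩
  ∑ (upTo n) f + f n         ≡⟨ cong (∑ (upTo n) f +_) fn≡f0 ⟩
  ∑ (upTo n) f + f 0         ≡⟨ ℕ.+-comm _ (f 0) ⟩
  f 0 + ∑ (upTo n) f         ∎)

∑-upTo-shift : (n a : ℕ) (f : ℕ → ℕ) → (∀ i → f (n + i) ≡ f i) →
               ∑[ i ∈ upTo n ] f (a + i) ≡ ∑ (upTo n) f
∑-upTo-shift n zero    f f-periodic = refl
∑-upTo-shift n (suc a) f f-periodic = begin
  ∑[ i ∈ upTo n ] f (suc a + i) ≡⟨ ∑-upTo-shift n a (f ∘ suc) (λ i → trans (cong f (sym (ℕ.+-suc n i))) (f-periodic (suc i))) ⟩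
  ∑ (upTo n) (f ∘ suc)          ≡⟨ ∑-upTo-rotate n f (trans (cong f (sym (ℕ.+-identityʳ n))) (f-periodic 0)) ⟩
  ∑ (upTo n) f                  ∎

∑-upTo-≟ : (n a : ℕ) → a < n → ∑[ i ∈ upTo n ] ⟦ a ℕ.≟ i ⟧ ≡ 1
∑-upTo-≟ (suc n) zero    _         =
  trans (∑-upTo-suc n (λ i → ⟦ 0 ℕ.≟ i ⟧)) (cong suc (∑-zero (upTo n) (λ _ _ → refl)))
∑-upTo-≟ (suc n) (suc a) (s≤s a<n) = begin
  ∑[ i ∈ upTo (suc n) ] ⟦ suc a ℕ.≟ i ⟧ ≡⟨ ∑-upTo-suc n (λ i → ⟦ suc a ℕ.≟ i ⟧) ⟩
  ∑[ i ∈ upTo n ] ⟦ suc a ℕ.≟ suc i ⟧   ≡⟨ ∑-cong (upTo n) (λ i → ⟦⟧-cong (suc a ℕ.≟ suc i) (a ℕ.≟ i) ℕ.suc-injective (cong suc)) ⟩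
  ∑[ i ∈ upTo n ] ⟦ a ℕ.≟ i ⟧           ≡⟨ ∑-upTo-≟ n a a<n ⟩
  1                                     ∎

∑-allFin : (n : ℕ) (f : ℕ → ℕ) → ∑ (allFin n) (f ∘ toℕ) ≡ ∑ (upTo n) f
∑-allFin zero    f = refl
∑-allFin (suc n) f = begin
  f 0 + ∑ (tabulate {n = n} Fin.suc) (f ∘ toℕ)      ≡⟨ cong (λ l → f 0 + ∑ l (f ∘ toℕ)) (List.map-tabulate {n = n} id Fin.suc) ⟨
  f 0 + ∑ (map Fin.suc (allFin n)) (f ∘ toℕ) ≡⟨ cong (f 0 +_) (∑-map Fin.suc (allFin n) (f ∘ toℕ)) ⟩
  f 0 + ∑ (allFin n) (f ∘ suc ∘ toℕ)        ≡⟨ cong (f 0 +_) (∑-allFin n (f ∘ suc)) ⟩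
  f 0 + ∑ (upTo n) (f ∘ suc)                ≡⟨ ∑-upTo-suc n f ⟨
  ∑ (upTo (suc n)) f                        ∎

-- Rotations of subsets.

rotations : ∀ {d} → ℕ → Subset d → Subset d
rotations zero    S = S
rotations (suc i) S = shift1 (rotations i S)

-- The left-hand side of this type is the function local to translate, which has no name here;
-- it is determined by the use in translate-rotations.
translate-go : ∀ {d} (ν : Fin d) (S : Subset d) (i : ℕ) → _ ≡ rotations i S

translate-rotations : ∀ {d} (ν : Fin d) (S : Subset d) → translate ν S ≡ rotations (toℕ ν) S
-- Abstracting `toℕ ν` leaves the local function applied to a variable, so the underscore in the
-- type of `translate-go` is solved by pattern unification.
translate-rotations ν S with toℕ ν
... | i = translate-go ν S i

translate-go ν S zero    = refl
translate-go ν S (suc i) = cong shift1 (translate-go ν S i)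

rotations-suc : ∀ {d} i (S : Subset d) → rotations (suc i) S ≡ rotations i (shift1 S)
rotations-suc zero    S = refl
rotations-suc (suc i) S = cong shift1 (rotations-suc i S)

-- The benefit of exponents in ℕ rather than `Fin d`: they add without reduction, and `rotations-d`
-- accounts for the modulus when it is needed.
rotations-+ : ∀ {d} i j (S : Subset d) → rotations (i + j) S ≡ rotations i (rotations j S)
rotations-+ zero    j S = refl
rotations-+ (suc i) j S = cong shift1 (rotations-+ i j S)

rotations-comm : ∀ {d} i j (S : Subset d) → rotations i (rotations j S) ≡ rotations j (rotations i S)
rotations-comm i j S = begin
  rotations i (rotations j S) ≡⟨ rotations-+ i j S ⟨
  rotations (i + j) S         ≡⟨ cong (λ n → rotations n S) (ℕ.+-comm i j) ⟩
  rotations (j + i) S         ≡⟨ rotations-+ j i S ⟩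
  rotations j (rotations i S) ∎

rotˡ : List Bool → List Bool
rotˡ []       = []
rotˡ (x ∷ xs) = xs ∷ʳ x

-- `shift1` takes its entry from the far end of the vector. Read backwards it moves the head of a
-- list to the end, so several shifts can be followed by recursion on the list.
reversed : ∀ {d} → Subset d → List Bool
reversed S = reverse (toList S)

length-reversed : ∀ {d} (S : Subset d) → length (reversed S) ≡ d
length-reversed S = trans (List.length-reverse (toList S)) (Vec.length-toList S)

reversed-∷ʳ : ∀ {d} (S : Subset d) b → reversed (S Vec.∷ʳ b) ≡ b ∷ reversed S
reversed-∷ʳ S b = trans (cong reverse (Vec.toList-∷ʳ b S)) (List.reverse-++ (toList S) (b ∷ []))

reversed-shift1 : ∀ {d} (S : Subset d) → reversed (shift1 S) ≡ rotˡ (reversed S)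
reversed-shift1 {zero}  []  = refl
reversed-shift1 {suc d} S with initLast S
... | S′ , b , refl = begin
  reverse (b ∷ toList S′)          ≡⟨ List.unfold-reverse b (toList S′) ⟩
  rotˡ (b ∷ reversed S′)           ≡⟨ cong rotˡ (reversed-∷ʳ S′ b) ⟨
  rotˡ (reversed (S′ Vec.∷ʳ b))    ∎

iterate-rotˡ : ℕ → List Bool → List Bool
iterate-rotˡ zero    xs = xs
iterate-rotˡ (suc i) xs = iterate-rotˡ i (rotˡ xs)

reversed-rotations : ∀ {d} i (S : Subset d) → reversed (rotations i S) ≡ iterate-rotˡ i (reversed S)
reversed-rotations zero    S = refl
reversed-rotations (suc i) S = begin
  reversed (rotations (suc i) S)       ≡⟨ cong reversed (rotations-suc i S) ⟩
  reversed (rotations i (shift1 S))    ≡⟨ reversed-rotations i (shift1 S) ⟩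
  iterate-rotˡ i (reversed (shift1 S)) ≡⟨ cong (iterate-rotˡ i) (reversed-shift1 S) ⟩
  iterate-rotˡ i (rotˡ (reversed S))   ∎

-- The suffix `ys` collects the heads already moved, which is the generality the induction needs; an
-- empty `ys` gives the full turn.
iterate-rotˡ-++ : ∀ xs ys → iterate-rotˡ (length xs) (xs ++ ys) ≡ ys ++ xs
iterate-rotˡ-++ []       ys = sym (List.++-identityʳ ys)
iterate-rotˡ-++ (x ∷ xs) ys = begin
  iterate-rotˡ (length xs) ((xs ++ ys) ∷ʳ x) ≡⟨ cong (iterate-rotˡ (length xs)) (List.++-assoc xs ys (x ∷ [])) ⟩
  iterate-rotˡ (length xs) (xs ++ (ys ∷ʳ x)) ≡⟨ iterate-rotˡ-++ xs (ys ∷ʳ x) ⟩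
  (ys ∷ʳ x) ++ xs                            ≡⟨ List.++-assoc ys (x ∷ []) xs ⟩
  ys ++ x ∷ xs                               ∎

rotations-d : ∀ {d} (S : Subset d) → rotations d S ≡ S
rotations-d {d} S = trans (sym (Vec.cast-is-id refl _)) (Vec.toList-injective refl _ S (List.reverse-injective (begin
  reversed (rotations d S)                          ≡⟨ reversed-rotations d S ⟩
  iterate-rotˡ d (reversed S)                       ≡⟨ cong₂ iterate-rotˡ (length-reversed S) (List.++-identityʳ (reversed S)) ⟨
  iterate-rotˡ (length (reversed S)) (reversed S ++ []) ≡⟨ iterate-rotˡ-++ (reversed S) [] ⟩
  reversed S                                        ∎)))

bit : Bool → ℕ
bit false = 0
bit true  = 1

headBit : List Bool → ℕ
headBit []      = 0
headBit (x ∷ _) = bit x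

-- The i-th turn brings the i-th entry of `xs` to the head; `ys` again collects what has been moved.
∑-headBit : ∀ xs ys → ∑[ i ∈ upTo (length xs) ] headBit (iterate-rotˡ i (xs ++ ys)) ≡ ∑ xs bit
∑-headBit []       ys = refl
∑-headBit (x ∷ xs) ys = begin
  ∑[ i ∈ upTo (suc (length xs)) ] headBit (iterate-rotˡ i (x ∷ xs ++ ys))
    ≡⟨ ∑-upTo-suc (length xs) (λ i → headBit (iterate-rotˡ i (x ∷ xs ++ ys))) ⟩
  bit x + (∑[ i ∈ upTo (length xs) ] headBit (iterate-rotˡ i ((xs ++ ys) ∷ʳ x)))
    ≡⟨ cong (λ l → bit x + (∑[ i ∈ upTo (length xs) ] headBit (iterate-rotˡ i l))) (List.++-assoc xs ys (x ∷ [])) ⟩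
  bit x + (∑[ i ∈ upTo (length xs) ] headBit (iterate-rotˡ i (xs ++ (ys ∷ʳ x))))
    ≡⟨ cong (bit x +_) (∑-headBit xs (ys ∷ʳ x)) ⟩
  bit x + ∑ xs bit ∎

∑-reverse : (xs : List Bool) → ∑ (reverse xs) bit ≡ ∑ xs bit
∑-reverse []       = refl
∑-reverse (x ∷ xs) = begin
  ∑ (reverse (x ∷ xs)) bit        ≡⟨ cong (λ l → ∑ l bit) (List.unfold-reverse x xs) ⟩
  ∑ (reverse xs ∷ʳ x) bit         ≡⟨ ∑-++ (reverse xs) (x ∷ []) bit ⟩
  ∑ (reverse xs) bit + (bit x + 0) ≡⟨ cong₂ _+_ (∑-reverse xs) (ℕ.+-identityʳ (bit x)) ⟩
  ∑ xs bit + bit x                ≡⟨ ℕ.+-comm _ (bit x) ⟩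
  bit x + ∑ xs bit                ∎

∑-toList : ∀ {d} (S : Subset d) → ∑ (toList S) bit ≡ ∣ S ∣
∑-toList []          = refl
∑-toList (true  ∷ S) = cong suc (∑-toList S)
∑-toList (false ∷ S) = ∑-toList S

-- Each of the d positions becomes the last one exactly once during a full turn.
∣∣≡∑-rotations : ∀ {d} (S : Subset d) → ∑[ i ∈ upTo d ] headBit (reversed (rotations i S)) ≡ ∣ S ∣
∣∣≡∑-rotations {d} S = begin
  ∑[ i ∈ upTo d ] headBit (reversed (rotations i S))
    ≡⟨ ∑-cong (upTo d) (λ i → cong headBit (trans (reversed-rotations i S) (cong (iterate-rotˡ i) (sym (List.++-identityʳ (reversed S)))))) ⟩
  ∑[ i ∈ upTo d ] headBit (iterate-rotˡ i (reversed S ++ []))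
    ≡⟨ cong (λ n → ∑[ i ∈ upTo n ] headBit (iterate-rotˡ i (reversed S ++ []))) (length-reversed S) ⟨
  ∑[ i ∈ upTo (length (reversed S)) ] headBit (iterate-rotˡ i (reversed S ++ []))
    ≡⟨ ∑-headBit (reversed S) [] ⟩
  ∑ (reversed S) bit ≡⟨ ∑-reverse (toList S) ⟩
  ∑ (toList S) bit   ≡⟨ ∑-toList S ⟩
  ∣ S ∣              ∎

∣shift1∣ : ∀ {d} (S : Subset d) → ∣ shift1 S ∣ ≡ ∣ S ∣
∣shift1∣ S = begin
  ∣ shift1 S ∣              ≡⟨ size (shift1 S) ⟨
  ∑ (reversed (shift1 S)) bit ≡⟨ cong (λ l → ∑ l bit) (reversed-shift1 S) ⟩
  ∑ (rotˡ (reversed S)) bit ≡⟨ ∑-rotˡ (reversed S) ⟩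
  ∑ (reversed S) bit        ≡⟨ size S ⟩
  ∣ S ∣                     ∎
  where
  size : ∀ {d} (S : Subset d) → ∑ (reversed S) bit ≡ ∣ S ∣
  size S = trans (∑-reverse (toList S)) (∑-toList S)

  ∑-rotˡ : ∀ xs → ∑ (rotˡ xs) bit ≡ ∑ xs bit
  ∑-rotˡ []       = refl
  ∑-rotˡ (x ∷ xs) = begin
    ∑ (xs ∷ʳ x) bit       ≡⟨ ∑-++ xs (x ∷ []) bit ⟩
    ∑ xs bit + (bit x + 0) ≡⟨ cong (∑ xs bit +_) (ℕ.+-identityʳ (bit x)) ⟩
    ∑ xs bit + bit x      ≡⟨ ℕ.+-comm _ (bit x) ⟩
    bit x + ∑ xs bit      ∎

∣rotations∣ : ∀ {d} i (S : Subset d) → ∣ rotations i S ∣ ≡ ∣ S ∣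
∣rotations∣ zero    S = refl
∣rotations∣ (suc i) S = trans (∣shift1∣ (rotations i S)) (∣rotations∣ i S)

rotations-periodic : ∀ {d} i (S : Subset d) → rotations (d + i) S ≡ rotations i S
rotations-periodic {d} i S = trans (rotations-+ d i S) (rotations-d (rotations i S))

-- The remaining shifts of a full turn undo the first one.
shift1-injective : ∀ {d} {S T : Subset d} → shift1 S ≡ shift1 T → S ≡ T
shift1-injective {zero}  {[]} {[]} _ = refl
shift1-injective {suc d} {S} {T} eq = begin
  S                      ≡⟨ rotations-d S ⟨
  rotations (suc d) S    ≡⟨ rotations-suc d S ⟩
  rotations d (shift1 S) ≡⟨ cong (rotations d) eq ⟩
  rotations d (shift1 T) ≡⟨ rotations-suc d T ⟨
  rotations (suc d) T    ≡⟨ rotations-d T ⟩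
  T                      ∎

rotations-injective : ∀ {d} i {S T : Subset d} → rotations i S ≡ rotations i T → S ≡ T
rotations-injective zero    eq = eq
rotations-injective (suc i) eq = rotations-injective i (shift1-injective eq)

rotations⇒SameOrbit : ∀ {d} i {S T : Subset d} → i < d → rotations i S ≡ T → SameOrbit S T
rotations⇒SameOrbit i {S} i<d eq = fromℕ< i<d ,
  trans (translate-rotations (fromℕ< i<d) S) (trans (cong (λ j → rotations j S) (toℕ-fromℕ< i<d)) eq)

SameOrbit⇒rotations : ∀ {d} {S T : Subset d} → SameOrbit S T → ∃ λ i → i < d × rotations i S ≡ T
SameOrbit⇒rotations {S = S} (ν , eq) = toℕ ν , toℕ<n ν , trans (sym (translate-rotations ν S)) eq

SameOrbit-sym : ∀ {d} {S T : Subset d} → SameOrbit S T → SameOrbit T S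
SameOrbit-sym {suc d} {S} S~T with SameOrbit⇒rotations S~T
-- Exponent 0 is its own inverse; subtracting it from the length would give an exponent outside the
-- range of `Fin`.
... | zero  , i<d , refl = rotations⇒SameOrbit 0 (s≤s z≤n) refl
... | suc i , i<d , refl = rotations⇒SameOrbit (suc d ∸ suc i) (s≤s (ℕ.m∸n≤m d i)) (begin
  rotations (d ∸ i) (rotations (suc i) S) ≡⟨ rotations-+ (d ∸ i) (suc i) S ⟨
  rotations (d ∸ i + suc i) S             ≡⟨ cong (λ n → rotations n S) (ℕ.m∸n+n≡m (ℕ.<⇒≤ i<d)) ⟩
  rotations (suc d) S                     ≡⟨ rotations-d S ⟩
  S                                       ∎)

-- Enumeration of the k-subsets.

subsets : (d k : ℕ) → List (Subset d)
subsets zero    zero    = [] ∷ []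
subsets zero    (suc k) = []
subsets (suc d) zero    = map (false ∷_) (subsets d zero)
subsets (suc d) (suc k) = map (true ∷_) (subsets d k) ++ map (false ∷_) (subsets d (suc k))

∈-subsets⇒∣∣ : ∀ d k {S : Subset d} → S ∈ subsets d k → ∣ S ∣ ≡ k
∈-subsets⇒∣∣ zero    zero    (here refl) = refl
∈-subsets⇒∣∣ (suc d) zero    S∈ with ∈-map⁻ (false ∷_) S∈
... | _ , S∈′ , refl = ∈-subsets⇒∣∣ d zero S∈′
∈-subsets⇒∣∣ (suc d) (suc k) S∈ with ∈-++⁻ (map (true ∷_) (subsets d k)) S∈
... | inj₁ S∈ˡ with ∈-map⁻ (true ∷_) S∈ˡ
...   | _ , S∈′ , refl = cong suc (∈-subsets⇒∣∣ d k S∈′)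
∈-subsets⇒∣∣ (suc d) (suc k) S∈ | inj₂ S∈ʳ with ∈-map⁻ (false ∷_) S∈ʳ
...   | _ , S∈′ , refl = ∈-subsets⇒∣∣ d (suc k) S∈′

-- The list `subsets d k` contains every subset of size `k` exactly once (`once`), so the indicator
-- of `T` acts as a delta function.
∑-subsets-≟ : ∀ d k (T : Subset d) (f : Subset d → ℕ) → ∣ T ∣ ≡ k →
              ∑[ S ∈ subsets d k ] (⟦ T ≟S S ⟧ * f S) ≡ f T
∑-subsets-≟ d k T f ∣T∣≡k = begin
  ∑[ S ∈ subsets d k ] (⟦ T ≟S S ⟧ * f S) ≡⟨ ∑-cong (subsets d k) term ⟩
  ∑[ S ∈ subsets d k ] (⟦ T ≟S S ⟧ * f T) ≡⟨ ∑-*ʳ (subsets d k) (f T) (λ S → ⟦ T ≟S S ⟧) ⟩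
  (∑[ S ∈ subsets d k ] ⟦ T ≟S S ⟧) * f T ≡⟨ cong (_* f T) (once d k T ∣T∣≡k) ⟩
  1 * f T                                 ≡⟨ ℕ.*-identityˡ (f T) ⟩
  f T                                     ∎
  where
  term : ∀ S → ⟦ T ≟S S ⟧ * f S ≡ ⟦ T ≟S S ⟧ * f T
  term S with T ≟S S
  ... | yes refl = refl
  ... | no _     = refl

  same : ∀ {d} b (T S : Subset d) → ⟦ (b ∷ T) ≟S (b ∷ S) ⟧ ≡ ⟦ T ≟S S ⟧
  same b T S = ⟦⟧-cong ((b ∷ T) ≟S (b ∷ S)) (T ≟S S) Vec.∷-injectiveʳ (cong (b ∷_))

  sameSum : ∀ {d} b (T : Subset d) Ss →
            ∑[ S ∈ map (b ∷_) Ss ] ⟦ (b ∷ T) ≟S S ⟧ ≡ ∑[ S ∈ Ss ] ⟦ T ≟S S ⟧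
  sameSum b T Ss = trans (∑-map (b ∷_) Ss (λ S → ⟦ (b ∷ T) ≟S S ⟧)) (∑-cong Ss (same b T))

  otherSum : ∀ {d} b c (T : Subset d) Ss → b ≢ c → ∑[ S ∈ map (c ∷_) Ss ] ⟦ (b ∷ T) ≟S S ⟧ ≡ 0
  otherSum b c T Ss b≢c = trans (∑-map (c ∷_) Ss (λ S → ⟦ (b ∷ T) ≟S S ⟧))
    (∑-zero Ss (λ S _ → ⟦⟧-no ((b ∷ T) ≟S (c ∷ S)) (b≢c ∘ Vec.∷-injectiveˡ)))

  once : ∀ d k (T : Subset d) → ∣ T ∣ ≡ k → ∑[ S ∈ subsets d k ] ⟦ T ≟S S ⟧ ≡ 1
  once zero    .0 [] refl = refl
  once (suc d) .(suc ∣ T ∣) (true ∷ T) refl = begin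
    ∑[ S ∈ subsets (suc d) (suc ∣ T ∣) ] ⟦ (true ∷ T) ≟S S ⟧
      ≡⟨ ∑-++ (map (true ∷_) (subsets d ∣ T ∣)) _ (λ S → ⟦ (true ∷ T) ≟S S ⟧) ⟩
    (∑[ S ∈ map (true ∷_) (subsets d ∣ T ∣) ] ⟦ (true ∷ T) ≟S S ⟧) + (∑[ S ∈ map (false ∷_) (subsets d (suc ∣ T ∣)) ] ⟦ (true ∷ T) ≟S S ⟧)
      ≡⟨ cong₂ _+_ (trans (sameSum true T (subsets d ∣ T ∣)) (once d ∣ T ∣ T refl)) (otherSum true false T (subsets d (suc ∣ T ∣)) (λ ())) ⟩
    1 ∎
  once (suc d) zero    (false ∷ T) ∣T∣≡0 = trans (sameSum false T (subsets d zero)) (once d zero T ∣T∣≡0)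
  once (suc d) (suc k) (false ∷ T) ∣T∣≡k = begin
    ∑[ S ∈ subsets (suc d) (suc k) ] ⟦ (false ∷ T) ≟S S ⟧
      ≡⟨ ∑-++ (map (true ∷_) (subsets d k)) _ (λ S → ⟦ (false ∷ T) ≟S S ⟧) ⟩
    (∑[ S ∈ map (true ∷_) (subsets d k) ] ⟦ (false ∷ T) ≟S S ⟧) + (∑[ S ∈ map (false ∷_) (subsets d (suc k)) ] ⟦ (false ∷ T) ≟S S ⟧)
      ≡⟨ cong₂ _+_ (otherSum false true T (subsets d k) (λ ())) (trans (sameSum false T (subsets d (suc k))) (once d (suc k) T ∣T∣≡k)) ⟩
    1 ∎

-- Orbits and stabilizers.

stabOrder-rotations : ∀ {d} (S : Subset d) → stabOrder S ≡ ∑[ i ∈ upTo d ] ⟦ rotations i S ≟S S ⟧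
stabOrder-rotations {d} S = begin
  stabOrder S ≡⟨ length-filter (λ ν → translate ν S ≟S S) (allFin d) ⟩
  ∑[ ν ∈ allFin d ] ⟦ translate ν S ≟S S ⟧
    ≡⟨ ∑-cong (allFin d) (λ ν → cong (λ T → ⟦ T ≟S S ⟧) (translate-rotations ν S)) ⟩
  ∑[ ν ∈ allFin d ] ⟦ rotations (toℕ ν) S ≟S S ⟧ ≡⟨ ∑-allFin d (λ i → ⟦ rotations i S ≟S S ⟧) ⟩
  ∑[ i ∈ upTo d ] ⟦ rotations i S ≟S S ⟧ ∎

-- The acting group is abelian, so a subset and its translates have the same stabilizer.
stabOrder-SameOrbit : ∀ {d} {S T : Subset d} → SameOrbit S T → stabOrder T ≡ stabOrder S
stabOrder-SameOrbit {d} {S} S~T with SameOrbit⇒rotations S~T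
... | a , _ , refl = begin
  stabOrder (rotations a S) ≡⟨ stabOrder-rotations (rotations a S) ⟩
  ∑[ i ∈ upTo d ] ⟦ rotations i (rotations a S) ≟S rotations a S ⟧ ≡⟨ ∑-cong (upTo d) (λ i →
     ⟦⟧-cong (rotations i (rotations a S) ≟S rotations a S) (rotations i S ≟S S)
       (λ eq → rotations-injective a (trans (rotations-comm a i S) eq))
       (λ eq → trans (rotations-comm i a S) (cong (rotations a) eq))) ⟩
  ∑[ i ∈ upTo d ] ⟦ rotations i S ≟S S ⟧ ≡⟨ stabOrder-rotations S ⟨
  stabOrder S ∎

-- The exponents carrying `S` to `T` form either the empty set or a coset of the stabilizer of `S`.
∑-rotations-≟ : ∀ {d} (S T : Subset d) →
                ∑[ i ∈ upTo d ] ⟦ rotations i S ≟S T ⟧ ≡ stabOrder S * ⟦ sameOrbit? S T ⟧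
∑-rotations-≟ {d} S T with sameOrbit? S T
... | no S≁T = trans
  (∑-zero (upTo d) (λ i i∈ → ⟦⟧-no (rotations i S ≟S T) (S≁T ∘ rotations⇒SameOrbit i (∈-upTo⁻ i∈))))
  (sym (ℕ.*-zeroʳ (stabOrder S)))
... | yes S~T with SameOrbit⇒rotations S~T
...   | a , _ , refl = begin
  ∑[ i ∈ upTo d ] ⟦ rotations i S ≟S rotations a S ⟧
    ≡⟨ ∑-upTo-shift d a (λ i → ⟦ rotations i S ≟S rotations a S ⟧) (λ i → cong (λ U → ⟦ U ≟S rotations a S ⟧) (rotations-periodic i S)) ⟨
  ∑[ i ∈ upTo d ] ⟦ rotations (a + i) S ≟S rotations a S ⟧ ≡⟨ ∑-cong (upTo d) (λ i →
     ⟦⟧-cong (rotations (a + i) S ≟S rotations a S) (rotations i S ≟S S)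
       (λ eq → rotations-injective a (trans (sym (rotations-+ a i S)) eq))
       (λ eq → trans (rotations-+ a i S) (cong (rotations a) eq))) ⟩
  ∑[ i ∈ upTo d ] ⟦ rotations i S ≟S S ⟧ ≡⟨ stabOrder-rotations S ⟨
  stabOrder S                            ≡⟨ ℕ.*-identityʳ (stabOrder S) ⟨
  stabOrder S * 1                        ∎

-- Orbit counting with a weight: a full turn visits each member of the orbit `stabOrder S` times.
-- The proof expands `f (rotations i S)` over all `T` by the delta function and interchanges the
-- sums.
∑-rotations : ∀ {d} (S : Subset d) (f : Subset d → ℕ) →
  ∑[ i ∈ upTo d ] f (rotations i S) ≡ stabOrder S * (∑[ T ∈ subsets d ∣ S ∣ ] (⟦ sameOrbit? S T ⟧ * f T))
∑-rotations {d} S f = begin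
  ∑[ i ∈ upTo d ] f (rotations i S)
    ≡⟨ ∑-cong (upTo d) (λ i → ∑-subsets-≟ d ∣ S ∣ (rotations i S) f (∣rotations∣ i S)) ⟨
  ∑[ i ∈ upTo d ] ∑[ T ∈ U ] (⟦ rotations i S ≟S T ⟧ * f T)
    ≡⟨ ∑-swap (upTo d) U (λ i T → ⟦ rotations i S ≟S T ⟧ * f T) ⟩
  ∑[ T ∈ U ] ∑[ i ∈ upTo d ] (⟦ rotations i S ≟S T ⟧ * f T)
    ≡⟨ ∑-cong U (λ T → trans (∑-*ʳ (upTo d) (f T) (λ i → ⟦ rotations i S ≟S T ⟧))
                   (trans (cong (_* f T) (∑-rotations-≟ S T)) (ℕ.*-assoc (stabOrder S) ⟦ sameOrbit? S T ⟧ (f T)))) ⟩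
  ∑[ T ∈ U ] (stabOrder S * (⟦ sameOrbit? S T ⟧ * f T))
    ≡⟨ ∑-*ˡ U (stabOrder S) (λ T → ⟦ sameOrbit? S T ⟧ * f T) ⟩
  stabOrder S * (∑[ T ∈ U ] (⟦ sameOrbit? S T ⟧ * f T)) ∎
  where U = subsets d ∣ S ∣

orbit-stabilizer : ∀ {d} (S : Subset d) →
                   stabOrder S * (∑[ T ∈ subsets d ∣ S ∣ ] ⟦ sameOrbit? S T ⟧) ≡ d
orbit-stabilizer {d} S = begin
  stabOrder S * (∑[ T ∈ subsets d ∣ S ∣ ] ⟦ sameOrbit? S T ⟧)
    ≡⟨ cong (stabOrder S *_) (∑-cong (subsets d ∣ S ∣) (λ T → ℕ.*-identityʳ ⟦ sameOrbit? S T ⟧)) ⟨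
  stabOrder S * (∑[ T ∈ subsets d ∣ S ∣ ] (⟦ sameOrbit? S T ⟧ * 1)) ≡⟨ ∑-rotations S (λ _ → 1) ⟨
  ∑[ i ∈ upTo d ] 1  ≡⟨ ∑-const (upTo d) 1 ⟩
  length (upTo d) * 1 ≡⟨ ℕ.*-identityʳ _ ⟩
  length (upTo d)    ≡⟨ List.length-upTo d ⟩
  d ∎

-- Summing 1, respectively the last bit, over a full turn exhibits d, respectively ∣ S ∣, as a
-- multiple of the stabilizer order.
stabOrder∣gcd : ∀ {d} (S : Subset d) → stabOrder S ∣ gcd d (∣ S ∣)
stabOrder∣gcd {d} S = gcd-greatest
  (divides (∑[ T ∈ U ] ⟦ sameOrbit? S T ⟧)
    (trans (sym (orbit-stabilizer S)) (ℕ.*-comm (stabOrder S) _)))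
  (divides (∑[ T ∈ U ] (⟦ sameOrbit? S T ⟧ * headBit (reversed T)))
    (trans (sym (∣∣≡∑-rotations S)) (trans (∑-rotations S (headBit ∘ reversed)) (ℕ.*-comm (stabOrder S) _))))
  where U = subsets d ∣ S ∣

-- The common length d/e of the orbits in M_e(d,k), where `e = suc i` as in `rhsTerm`; the value 0
-- discards every e that does not divide `gcd d k`.
cofactor : (d k i : ℕ) → ℕ
cofactor d k i with suc i ∣? gcd d k
... | yes e∣gcd = quotient (∣-trans e∣gcd (gcd[m,n]∣m d k))
... | no  _     = 0

-- Grouping sums over k-subsets by orbit representatives.

module _ {d k : ℕ} (0<d : 0 < d) {T : ℕ → List (Subset d)}
         (transversal : ∀ e → e ∣ gcd d k → IsTransversal d k e (T e)) where

  private
    U : List (Subset d)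
    U = subsets d k

    δ : ℕ → ℕ
    δ i = ⟦ suc i ∣? gcd d k ⟧

    meets : ℕ → Subset d → ℕ
    meets i S = ∑[ R ∈ T (suc i) ] ⟦ sameOrbit? S R ⟧

  -- The transversal condition is given only for divisors of `gcd d k`; `stabOrder∣gcd` makes it
  -- available for the stratum of `S`.
  meets-own-stratum : (S : Subset d) → ∣ S ∣ ≡ k → ∀ i → stabOrder S ≡ suc i → δ i * meets i S ≡ 1
  meets-own-stratum S ∣S∣≡k i stab≡ = begin
    δ i * meets i S
      ≡⟨ cong₂ _*_ (⟦⟧-yes (suc i ∣? gcd d k) e∣gcd) (sym (length-filter (sameOrbit? S) (T (suc i)))) ⟩
    1 * length (filter (sameOrbit? S) (T (suc i)))
      ≡⟨ cong (1 *_) (proj₂ (transversal (suc i) e∣gcd) S (∣S∣≡k , stab≡)) ⟩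
    1 ∎
    where
    e∣gcd : suc i ∣ gcd d k
    e∣gcd = subst₂ (λ e n → e ∣ gcd d n) stab≡ ∣S∣≡k (stabOrder∣gcd S)

  -- Representatives in `T (suc i)` have stabilizer order `suc i`, and this order is constant on
  -- orbits.
  meets-other-stratum : (S : Subset d) → ∀ i → stabOrder S ≢ suc i → δ i * meets i S ≡ 0
  meets-other-stratum S i stab≢ with suc i ∣? gcd d k
  ... | no _      = refl
  ... | yes e∣gcd = trans (ℕ.*-identityˡ _) (∑-zero (T (suc i)) (λ R R∈T → ⟦⟧-no (sameOrbit? S R)
    (λ S~R → stab≢ (trans (sym (stabOrder-SameOrbit S~R)) (proj₂ (proj₁ (transversal (suc i) e∣gcd) R R∈T))))))

  meets-once : (S : Subset d) → ∣ S ∣ ≡ k → ∑[ i ∈ upTo d ] (δ i * meets i S) ≡ 1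
  meets-once S ∣S∣≡k with stabOrder S in stab≡ | orbit-stabilizer S
  -- Order 0 would annihilate the product in `orbit-stabilizer`, which equals `d > 0`.
  ... | zero  | 0≡d = contradiction 0<d (ℕ.≤⇒≯ (ℕ.≤-reflexive (sym 0≡d)))
  ... | suc e | orb = trans (∑-cong (upTo d) term) (∑-upTo-≟ d e e<d)
    where
    e<d : e < d
    -- The order `suc e` divides `d`, so the index of the stratum of `S` does occur in `upTo d`.
    e<d = ∣⇒≤ {{>-nonZero 0<d}} (divides (∑[ R ∈ subsets d ∣ S ∣ ] ⟦ sameOrbit? S R ⟧) (trans (sym orb) (ℕ.*-comm (suc e) _)))

    term : ∀ i → δ i * meets i S ≡ ⟦ e ℕ.≟ i ⟧
    term i with e ℕ.≟ i
    ... | yes refl = meets-own-stratum S ∣S∣≡k i stab≡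
    ... | no e≢i   = meets-other-stratum S i (λ eq → e≢i (ℕ.suc-injective (trans (sym stab≡) eq)))

  module _ {f : Subset d → ℕ} (f-invariant : ∀ {S R} → ∣ S ∣ ≡ k → SameOrbit S R → f S ≡ f R) where

    -- Invariance replaces `f S` by `f R` on the orbit, and symmetry of the relation turns the
    -- remaining sum into the orbit length counted from `R`.
    ∑-orbit : ∀ R → ∣ R ∣ ≡ k → stabOrder R * (∑[ S ∈ U ] (f S * ⟦ sameOrbit? S R ⟧)) ≡ d * f R
    ∑-orbit R refl = begin
      stabOrder R * (∑[ S ∈ U ] (f S * ⟦ sameOrbit? S R ⟧)) ≡⟨ cong (stabOrder R *_) (∑-cong-∈ U term) ⟩
      stabOrder R * (∑[ S ∈ U ] (⟦ sameOrbit? R S ⟧ * f R))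
        ≡⟨ cong (stabOrder R *_) (∑-*ʳ U (f R) (λ S → ⟦ sameOrbit? R S ⟧)) ⟩
      stabOrder R * ((∑[ S ∈ U ] ⟦ sameOrbit? R S ⟧) * f R) ≡⟨ ℕ.*-assoc (stabOrder R) _ (f R) ⟨
      stabOrder R * (∑[ S ∈ U ] ⟦ sameOrbit? R S ⟧) * f R   ≡⟨ cong (_* f R) (orbit-stabilizer R) ⟩
      d * f R ∎
      where
      term : ∀ S → S ∈ U → f S * ⟦ sameOrbit? S R ⟧ ≡ ⟦ sameOrbit? R S ⟧ * f R
      term S S∈U with sameOrbit? S R | sameOrbit? R S
      ... | yes S~R | yes _   = trans (ℕ.*-identityʳ (f S)) (trans (f-invariant (∈-subsets⇒∣∣ d k S∈U) S~R) (sym (ℕ.*-identityˡ (f R))))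
      ... | no _    | no _    = ℕ.*-zeroʳ (f S)
      ... | yes S~R | no R≁S  = contradiction (SameOrbit-sym S~R) R≁S
      ... | no S≁R  | yes R~S = contradiction (SameOrbit-sym R~S) S≁R

    ∑-stratum : ∀ i → δ i * (∑[ R ∈ T (suc i) ] ∑[ S ∈ U ] (f S * ⟦ sameOrbit? S R ⟧)) ≡
                      cofactor d k i * ∑ (T (suc i)) f
    ∑-stratum i with suc i ∣? gcd d k
    ... | no _      = refl
    ... | yes e∣gcd = begin
      1 * (∑[ R ∈ T (suc i) ] ∑[ S ∈ U ] (f S * ⟦ sameOrbit? S R ⟧)) ≡⟨ ℕ.*-identityˡ _ ⟩
      ∑[ R ∈ T (suc i) ] ∑[ S ∈ U ] (f S * ⟦ sameOrbit? S R ⟧)       ≡⟨ ∑-cong-∈ (T (suc i)) term ⟩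
      ∑[ R ∈ T (suc i) ] (q * f R)                                   ≡⟨ ∑-*ˡ (T (suc i)) q f ⟩
      q * ∑ (T (suc i)) f                                            ∎
      where
      e∣d : suc i ∣ d
      e∣d = ∣-trans e∣gcd (gcd[m,n]∣m d k)

      q : ℕ
      q = quotient e∣d

      term : ∀ R → R ∈ T (suc i) → ∑[ S ∈ U ] (f S * ⟦ sameOrbit? S R ⟧) ≡ q * f R
      term R R∈T with proj₁ (transversal (suc i) e∣gcd) R R∈T
      ... | ∣R∣≡k , stab≡ = ℕ.*-cancelˡ-≡ _ _ (suc i) (begin
        suc i * (∑[ S ∈ U ] (f S * ⟦ sameOrbit? S R ⟧))     ≡⟨ cong (_* (∑[ S ∈ U ] (f S * ⟦ sameOrbit? S R ⟧))) stab≡ ⟨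
        stabOrder R * (∑[ S ∈ U ] (f S * ⟦ sameOrbit? S R ⟧)) ≡⟨ ∑-orbit R ∣R∣≡k ⟩
        d * f R             ≡⟨ cong (_* f R) (trans (_∣_.equality e∣d) (ℕ.*-comm q (suc i))) ⟩
        suc i * q * f R     ≡⟨ ℕ.*-assoc (suc i) q (f R) ⟩
        suc i * (q * f R)   ∎)

    -- Each `f S` is multiplied by the 1 of `meets-once`; after interchanging sums, every
    -- representative collects its whole orbit, evaluated by `∑-stratum`. It is applied later to
    -- `zS` and to the constant 1.
    ∑-subsets : ∑ U f ≡ ∑[ i ∈ upTo d ] (cofactor d k i * ∑ (T (suc i)) f)
    ∑-subsets = begin
      ∑ U f ≡⟨ ∑-cong-∈ U (λ S S∈U → trans (sym (ℕ.*-identityʳ (f S))) (cong (f S *_) (sym (meets-once S (∈-subsets⇒∣∣ d k S∈U))))) ⟩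
      ∑[ S ∈ U ] (f S * (∑[ i ∈ upTo d ] (δ i * meets i S)))
        ≡⟨ ∑-cong U (λ S → trans (sym (∑-*ˡ (upTo d) (f S) (λ i → δ i * meets i S))) (∑-cong (upTo d) (λ i → *-xyz≈yxz (f S) (δ i) (meets i S)))) ⟩
      ∑[ S ∈ U ] ∑[ i ∈ upTo d ] (δ i * (f S * meets i S))
        ≡⟨ ∑-swap U (upTo d) (λ S i → δ i * (f S * meets i S)) ⟩
      ∑[ i ∈ upTo d ] ∑[ S ∈ U ] (δ i * (f S * meets i S))
        ≡⟨ ∑-cong (upTo d) (λ i → trans (∑-*ˡ U (δ i) (λ S → f S * meets i S)) (trans (cong (δ i *_) (regroup i)) (∑-stratum i))) ⟩
      ∑[ i ∈ upTo d ] (cofactor d k i * ∑ (T (suc i)) f) ∎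
      where
      regroup : ∀ i → ∑[ S ∈ U ] (f S * meets i S) ≡ ∑[ R ∈ T (suc i) ] ∑[ S ∈ U ] (f S * ⟦ sameOrbit? S R ⟧)
      regroup i = trans (∑-cong U (λ S → sym (∑-*ˡ (T (suc i)) (f S) (λ R → ⟦ sameOrbit? S R ⟧))))
                        (∑-swap U (T (suc i)) (λ S R → f S * ⟦ sameOrbit? S R ⟧))

-- Formal products, elementary symmetric functions and subsets.

∑-mulF : (a b : List ℕ) (φ : ℕ → ℕ) → ∑ (mulF a b) φ ≡ ∑[ x ∈ a ] ∑[ y ∈ b ] φ (x + y)
∑-mulF a b φ = trans (∑-concatMap (λ x → map (x +_) b) a φ) (∑-cong a (λ x → ∑-map (x +_) b φ))

∑-mulF-++ : (a b c : List ℕ) (φ : ℕ → ℕ) → ∑ (mulF a (b ++ c)) φ ≡ ∑ (mulF a b) φ + ∑ (mulF a c) φ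
∑-mulF-++ a b c φ = begin
  ∑ (mulF a (b ++ c)) φ ≡⟨ ∑-mulF a (b ++ c) φ ⟩
  ∑[ x ∈ a ] ∑[ y ∈ b ++ c ] φ (x + y) ≡⟨ ∑-cong a (λ x → ∑-++ b c (λ y → φ (x + y))) ⟩
  ∑[ x ∈ a ] ((∑[ y ∈ b ] φ (x + y)) + (∑[ y ∈ c ] φ (x + y)))
    ≡⟨ ∑-+ a (λ x → ∑[ y ∈ b ] φ (x + y)) (λ x → ∑[ y ∈ c ] φ (x + y)) ⟩
  (∑[ x ∈ a ] ∑[ y ∈ b ] φ (x + y)) + (∑[ x ∈ a ] ∑[ y ∈ c ] φ (x + y))
    ≡⟨ cong₂ _+_ (∑-mulF a b φ) (∑-mulF a c φ) ⟨
  ∑ (mulF a b) φ + ∑ (mulF a c) φ ∎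

-- Agreement for every `φ` is equality of multisets. Quantifying over `φ` is essential: the inner
-- test function is translated by each `x`.
∑-mulF-congʳ : (a : List ℕ) {b c : List ℕ} → (∀ φ → ∑ b φ ≡ ∑ c φ) → ∀ φ → ∑ (mulF a b) φ ≡ ∑ (mulF a c) φ
∑-mulF-congʳ a {b} {c} b≈c φ =
  trans (∑-mulF a b φ) (trans (∑-cong a (λ x → b≈c (λ y → φ (x + y)))) (sym (∑-mulF a c φ)))

∑-mulF-mulF : (a b c : List ℕ) (φ : ℕ → ℕ) →
              ∑ (mulF a (mulF b c)) φ ≡ ∑[ x ∈ a ] ∑[ y ∈ b ] ∑[ z ∈ c ] φ (x + (y + z))
∑-mulF-mulF a b c φ = trans (∑-mulF a (mulF b c) φ) (∑-cong a (λ x → ∑-mulF b c (λ y → φ (x + y))))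

∑-mulF-swap : (a b c : List ℕ) (φ : ℕ → ℕ) → ∑ (mulF a (mulF b c)) φ ≡ ∑ (mulF b (mulF a c)) φ
∑-mulF-swap a b c φ = begin
  ∑ (mulF a (mulF b c)) φ ≡⟨ ∑-mulF-mulF a b c φ ⟩
  ∑[ x ∈ a ] ∑[ y ∈ b ] ∑[ z ∈ c ] φ (x + (y + z)) ≡⟨ ∑-swap a b (λ x y → ∑[ z ∈ c ] φ (x + (y + z))) ⟩
  ∑[ y ∈ b ] ∑[ x ∈ a ] ∑[ z ∈ c ] φ (x + (y + z))
    ≡⟨ ∑-cong b (λ y → ∑-cong a (λ x → ∑-cong c (λ z → cong φ (+-xyz≈yxz x y z)))) ⟩
  ∑[ y ∈ b ] ∑[ x ∈ a ] ∑[ z ∈ c ] φ (y + (x + z)) ≡⟨ ∑-mulF-mulF b a c φ ⟨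
  ∑ (mulF b (mulF a c)) φ ∎

∑-allSums-∷ʳ : ∀ Ms M (φ : ℕ → ℕ) → ∑ (allSums (Ms ∷ʳ M)) φ ≡ ∑ (allSums (M ∷ Ms)) φ
∑-allSums-∷ʳ []       M φ = refl
∑-allSums-∷ʳ (N ∷ Ms) M φ =
  trans (∑-mulF-congʳ N (∑-allSums-∷ʳ Ms M) φ) (∑-mulF-swap N M (allSums Ms) φ)

∑-esym-∷ : ∀ k x xs φ → ∑ (esym (suc k) (x ∷ xs)) φ ≡ ∑ (mulF x (esym k xs)) φ + ∑ (esym (suc k) xs) φ
∑-esym-∷ k x xs φ = ∑-++ (mulF x (esym k xs)) (esym (suc k) xs) φ

-- Extracting both heads in degree k + 2 gives x y e_k + x e_(k+1) + y e_(k+1) + e_(k+2) in the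
-- remaining periods, which is symmetric in x and y. In degree 1 there is no mixed term, hence the
-- separate case.
∑-esym-swap : ∀ k x y xs φ → ∑ (esym k (x ∷ y ∷ xs)) φ ≡ ∑ (esym k (y ∷ x ∷ xs)) φ
∑-esym-swap zero          x y xs φ = refl
∑-esym-swap (suc zero)    x y xs φ = begin
  ∑ (esym 1 (x ∷ y ∷ xs)) φ ≡⟨ ∑-esym-∷ 0 x (y ∷ xs) φ ⟩
  one x + ∑ (esym 1 (y ∷ xs)) φ ≡⟨ cong (one x +_) (∑-esym-∷ 0 y xs φ) ⟩
  one x + (one y + rest)        ≡⟨ +-xyz≈yxz (one x) (one y) rest ⟩
  one y + (one x + rest)        ≡⟨ cong (one y +_) (∑-esym-∷ 0 x xs φ) ⟨
  one y + ∑ (esym 1 (x ∷ xs)) φ ≡⟨ ∑-esym-∷ 0 y (x ∷ xs) φ ⟨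
  ∑ (esym 1 (y ∷ x ∷ xs)) φ ∎
  where
  one : List ℕ → ℕ
  one z = ∑ (mulF z (0 ∷ [])) φ
  rest : ℕ
  rest = ∑ (esym 1 xs) φ
∑-esym-swap (suc (suc k)) x y xs φ = begin
  ∑ (esym (2 + k) (x ∷ y ∷ xs)) φ ≡⟨ expand x y ⟩
  (two x y + one x) + (one y + rest) ≡⟨ cong (λ n → (n + one x) + (one y + rest)) (∑-mulF-swap x y (esym k xs) φ) ⟩
  (two y x + one x) + (one y + rest) ≡⟨ +-interchange (two y x) (one x) (one y) rest ⟩
  (two y x + one y) + (one x + rest) ≡⟨ expand y x ⟨
  ∑ (esym (2 + k) (y ∷ x ∷ xs)) φ ∎
  where
  one : List ℕ → ℕ
  one z = ∑ (mulF z (esym (suc k) xs)) φ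
  two : List ℕ → List ℕ → ℕ
  two z w = ∑ (mulF z (mulF w (esym k xs))) φ
  rest : ℕ
  rest = ∑ (esym (2 + k) xs) φ
  expand : ∀ z w → ∑ (esym (2 + k) (z ∷ w ∷ xs)) φ ≡ (two z w + one z) + (one w + rest)
  expand z w = trans (∑-esym-∷ (suc k) z (w ∷ xs) φ)
    (cong₂ _+_ (∑-mulF-++ z (mulF w (esym k xs)) (esym (suc k) xs) φ) (∑-esym-∷ (suc k) w xs φ))

∑-esym-∷ʳ : ∀ k xs y φ → ∑ (esym k (xs ∷ʳ y)) φ ≡ ∑ (esym k (y ∷ xs)) φ
∑-esym-∷ʳ zero    xs       y φ = refl
∑-esym-∷ʳ (suc k) []       y φ = refl
∑-esym-∷ʳ (suc k) (x ∷ xs) y φ = begin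
  ∑ (esym (suc k) (x ∷ xs ∷ʳ y)) φ ≡⟨ ∑-esym-∷ k x (xs ∷ʳ y) φ ⟩
  ∑ (mulF x (esym k (xs ∷ʳ y))) φ + ∑ (esym (suc k) (xs ∷ʳ y)) φ
    ≡⟨ cong₂ _+_ (∑-mulF-congʳ x (∑-esym-∷ʳ k xs y) φ) (∑-esym-∷ʳ (suc k) xs y φ) ⟩
  ∑ (mulF x (esym k (y ∷ xs))) φ + ∑ (esym (suc k) (y ∷ xs)) φ ≡⟨ ∑-esym-∷ k x (y ∷ xs) φ ⟨
  ∑ (esym (suc k) (x ∷ y ∷ xs)) φ ≡⟨ ∑-esym-swap (suc k) x y xs φ ⟩
  ∑ (esym (suc k) (y ∷ x ∷ xs)) φ ∎

map-upTo-suc : {A : Set} (C : ℕ → A) (n : ℕ) → map C (upTo (suc n)) ≡ C 0 ∷ map (C ∘ suc) (upTo n)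
map-upTo-suc C n = cong (C 0 ∷_) (trans (List.map-applyUpTo suc C n) (sym (List.map-upTo (C ∘ suc) n)))

-- `esym` and `subsets` split alike, according to whether the first index is chosen. The induction
-- shifts the family to `C ∘ suc` and translates `φ` by the elements of `C 0`, so both must be
-- arbitrary.
∑-esym-subsets : ∀ n k (C : ℕ → List ℕ) φ →
                 ∑ (esym k (map C (upTo n))) φ ≡ ∑[ S ∈ subsets n k ] ∑ (allSums (map C (elems S))) φ
∑-esym-subsets zero    zero    C φ = cong (_+ 0) (sym (ℕ.+-identityʳ (φ 0)))
∑-esym-subsets zero    (suc k) C φ = refl
∑-esym-subsets (suc n) k       C φ = begin
  ∑ (esym k (map C (upTo (suc n)))) φ ≡⟨ cong (λ l → ∑ (esym k l) φ) (map-upTo-suc C n) ⟩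
  ∑ (esym k (C 0 ∷ C′s)) φ            ≡⟨ split k ⟩
  ∑ (subsets (suc n) k) F             ∎
  where
  C′s : List (List ℕ)
  C′s = map (C ∘ suc) (upTo n)

  F : Subset (suc n) → ℕ
  F S = ∑ (allSums (map C (elems S))) φ

  F-false : ∀ k → ∑ (map (false ∷_) (subsets n k)) F ≡ ∑ (esym k C′s) φ
  F-false k = begin
    ∑ (map (false ∷_) (subsets n k)) F ≡⟨ ∑-map (false ∷_) (subsets n k) F ⟩
    ∑[ S ∈ subsets n k ] F (false ∷ S)
      ≡⟨ ∑-cong (subsets n k) (λ S → cong (λ l → ∑ (allSums l) φ) (List.map-∘ (elems S))) ⟨
    ∑[ S ∈ subsets n k ] ∑ (allSums (map (C ∘ suc) (elems S))) φ ≡⟨ ∑-esym-subsets n k (C ∘ suc) φ ⟨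
    ∑ (esym k C′s) φ ∎

  F-true : ∀ k → ∑ (map (true ∷_) (subsets n k)) F ≡ ∑ (mulF (C 0) (esym k C′s)) φ
  F-true k = begin
    ∑ (map (true ∷_) (subsets n k)) F ≡⟨ ∑-map (true ∷_) (subsets n k) F ⟩
    ∑[ S ∈ subsets n k ] F (true ∷ S)
      ≡⟨ ∑-cong (subsets n k) (λ S → trans (∑-mulF (C 0) (allSums (map C (map suc (elems S)))) φ)
           (∑-cong (C 0) (λ x → cong (λ l → ∑ (allSums l) (λ y → φ (x + y))) (sym (List.map-∘ (elems S)))))) ⟩
    ∑[ S ∈ subsets n k ] ∑[ x ∈ C 0 ] ∑[ y ∈ allSums (map (C ∘ suc) (elems S)) ] φ (x + y)
      ≡⟨ ∑-swap (subsets n k) (C 0) (λ S x → ∑[ y ∈ allSums (map (C ∘ suc) (elems S)) ] φ (x + y)) ⟩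
    ∑[ x ∈ C 0 ] ∑[ S ∈ subsets n k ] ∑[ y ∈ allSums (map (C ∘ suc) (elems S)) ] φ (x + y)
      ≡⟨ ∑-cong (C 0) (λ x → ∑-esym-subsets n k (C ∘ suc) (λ y → φ (x + y))) ⟨
    ∑[ x ∈ C 0 ] ∑[ y ∈ esym k C′s ] φ (x + y) ≡⟨ ∑-mulF (C 0) (esym k C′s) φ ⟨
    ∑ (mulF (C 0) (esym k C′s)) φ ∎

  split : ∀ k → ∑ (esym k (C 0 ∷ C′s)) φ ≡ ∑ (subsets (suc n) k) F
  split zero    = sym (F-false zero)
  split (suc k) = begin
    ∑ (esym (suc k) (C 0 ∷ C′s)) φ ≡⟨ ∑-esym-∷ k (C 0) C′s φ ⟩
    ∑ (mulF (C 0) (esym k C′s)) φ + ∑ (esym (suc k) C′s) φ ≡⟨ cong₂ _+_ (F-true k) (F-false (suc k)) ⟨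
    ∑ (map (true ∷_) (subsets n k)) F + ∑ (map (false ∷_) (subsets n (suc k))) F
      ≡⟨ ∑-++ (map (true ∷_) (subsets n k)) (map (false ∷_) (subsets n (suc k))) F ⟨
    ∑ (subsets (suc n) (suc k)) F ∎

elems-∷ʳ-true : ∀ {n} (S : Subset n) → elems (S Vec.∷ʳ true) ≡ elems S ∷ʳ n
elems-∷ʳ-true []          = refl
elems-∷ʳ-true (true ∷ S)  = cong (0 ∷_) (trans (cong (map suc) (elems-∷ʳ-true S)) (List.map-++ suc (elems S) _))
elems-∷ʳ-true (false ∷ S) = trans (cong (map suc) (elems-∷ʳ-true S)) (List.map-++ suc (elems S) _)

elems-∷ʳ-false : ∀ {n} (S : Subset n) → elems (S Vec.∷ʳ false) ≡ elems S
elems-∷ʳ-false []          = refl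
elems-∷ʳ-false (true ∷ S)  = cong (λ l → 0 ∷ map suc l) (elems-∷ʳ-false S)
elems-∷ʳ-false (false ∷ S) = cong (map suc) (elems-∷ʳ-false S)

length-elems : ∀ {n} (S : Subset n) → length (elems S) ≡ ∣ S ∣
length-elems []          = refl
length-elems (true ∷ S)  = cong suc (trans (List.length-map suc (elems S)) (length-elems S))
length-elems (false ∷ S) = trans (List.length-map suc (elems S)) (length-elems S)

-- Multisets of residues modulo p under multiplication.

module Residues (q : ℕ) where

  private
    p : ℕ
    p = suc q

  infix 4 _≈_
  _≈_ : ℕ → ℕ → Set
  x ≈ y = x mod p ≡ y mod p

  mod-≈ : ∀ x → x mod p ≈ x
  mod-≈ x = m%n%n≡m%n x p

  +-cong-≈ : ∀ {x x′ y y′} → x ≈ x′ → y ≈ y′ → x + y ≈ x′ + y′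
  +-cong-≈ {x} {x′} {y} {y′} x≈ y≈ =
    trans (%-distribˡ-+ x y p) (trans (cong₂ (λ a b → (a + b) % p) x≈ y≈) (sym (%-distribˡ-+ x′ y′ p)))

  *-cong-≈ : ∀ {x x′ y y′} → x ≈ x′ → y ≈ y′ → x * y ≈ x′ * y′
  *-cong-≈ {x} {x′} {y} {y′} x≈ y≈ =
    trans (%-distribˡ-* x y p) (trans (cong₂ (λ a b → (a * b) % p) x≈ y≈) (sym (%-distribˡ-* x′ y′ p)))

  ≡⇒≈ : ∀ {x y} → x ≡ y → x ≈ y
  ≡⇒≈ = cong (_mod p)

  Periodic : (ℕ → ℕ) → Set
  Periodic φ = ∀ x y → x ≈ y → φ x ≡ φ y

  -- In 𝔽_p, the multiset L′ is c times the multiset L.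
  record Scaled (c : ℕ) (L L′ : List ℕ) : Set where
    constructor scaled
    field ∑-scaled : ∀ φ → Periodic φ → ∑[ x ∈ L ] φ (c * x) ≡ ∑ L′ φ
  open Scaled public

  -- Since c(x + y) = cx + cy, the factors can be replaced one at a time; with the other summand
  -- fixed, the test function stays periodic.
  Scaled-mulF : ∀ {c a a′ b b′} → Scaled c a a′ → Scaled c b b′ → Scaled c (mulF a b) (mulF a′ b′)
  Scaled-mulF {c} {a} {a′} {b} {b′} ra rb = scaled λ φ φ-per → begin
    ∑[ x ∈ mulF a b ] φ (c * x)              ≡⟨ ∑-mulF a b (λ x → φ (c * x)) ⟩
    ∑[ x ∈ a ] ∑[ y ∈ b ] φ (c * (x + y))
      ≡⟨ ∑-cong a (λ x → ∑-cong b (λ y → cong φ (ℕ.*-distribˡ-+ c x y))) ⟩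
    ∑[ x ∈ a ] ∑[ y ∈ b ] φ (c * x + c * y)
      ≡⟨ ∑-cong a (λ x → ∑-scaled rb (λ z → φ (c * x + z)) (λ z z′ z≈ → φ-per _ _ (+-cong-≈ {c * x} {c * x} {z} {z′} refl z≈))) ⟩
    ∑[ x ∈ a ] ∑[ y ∈ b′ ] φ (c * x + y)
      ≡⟨ ∑-scaled ra (λ z → ∑[ y ∈ b′ ] φ (z + y)) (λ z z′ z≈ → ∑-cong b′ (λ y → φ-per _ _ (+-cong-≈ {z} {z′} {y} {y} z≈ refl))) ⟩
    ∑[ x ∈ a′ ] ∑[ y ∈ b′ ] φ (x + y)        ≡⟨ ∑-mulF a′ b′ φ ⟨
    ∑ (mulF a′ b′) φ                         ∎

  Scaled-++ : ∀ {c a a′ b b′} → Scaled c a a′ → Scaled c b b′ → Scaled c (a ++ b) (a′ ++ b′)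
  Scaled-++ {c} {a} {a′} {b} {b′} ra rb = scaled λ φ φ-per →
    trans (∑-++ a b (λ x → φ (c * x))) (trans (cong₂ _+_ (∑-scaled ra φ φ-per) (∑-scaled rb φ φ-per)) (sym (∑-++ a′ b′ φ)))

  Scaled-0 : ∀ {c} → Scaled c (0 ∷ []) (0 ∷ [])
  Scaled-0 {c} = scaled λ φ φ-per → cong (λ n → φ n + 0) (ℕ.*-zeroʳ c)

  Scaled-esym : ∀ {c} k {xs ys} → Pointwise (Scaled c) xs ys → Scaled c (esym k xs) (esym k ys)
  Scaled-esym zero    rs       = Scaled-0
  Scaled-esym (suc k) []       = scaled λ _ _ → refl
  Scaled-esym (suc k) (r ∷ rs) =
    Scaled-++ (Scaled-mulF r (Scaled-esym k rs)) (Scaled-esym (suc k) rs)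

  Scaled-allSums : ∀ {c xs ys} → Pointwise (Scaled c) xs ys → Scaled c (allSums xs) (allSums ys)
  Scaled-allSums []       = Scaled-0
  Scaled-allSums (r ∷ rs) = Scaled-mulF r (Scaled-allSums rs)

  residue : ℕ → ℕ → ℕ
  residue r x = ⟦ x mod p ℕ.≟ r ⟧

  residue-periodic : ∀ r → Periodic (residue r)
  residue-periodic r _ _ = cong (λ n → ⟦ n ℕ.≟ r ⟧)

  coeff-∑ : ∀ E r → coeff p E r ≡ ∑ E (residue r)
  coeff-∑ E r = length-filter (λ x → (x mod p) ℕ.≟ r) E

  ∑-coeff : ∀ E → ∑[ r ∈ upTo p ] coeff p E r ≡ length E
  ∑-coeff E = begin
    ∑[ r ∈ upTo p ] coeff p E r              ≡⟨ ∑-cong (upTo p) (coeff-∑ E) ⟩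
    ∑[ r ∈ upTo p ] ∑[ x ∈ E ] residue r x   ≡⟨ ∑-swap (upTo p) E residue ⟩
    ∑[ x ∈ E ] ∑[ r ∈ upTo p ] residue r x   ≡⟨ ∑-cong E (λ x → ∑-upTo-≟ p (x mod p) (m%n<n x p)) ⟩
    ∑[ x ∈ E ] 1                             ≡⟨ ∑-const E 1 ⟩
    length E * 1                             ≡⟨ ℕ.*-identityʳ (length E) ⟩
    length E                                 ∎

-- Powers of a primitive root.

module PrimitiveRoot (q g : ℕ) (1<q : 1 < q) (primitive-root : IsPrimitiveRoot (suc q) g) where

  open Residues q

  private
    p : ℕ
    p = suc q

    1≉0 : ¬ (1 ≈ 0)
    1≉0 1≈0 with trans (sym (m<n⇒m%n≡m (ℕ.m<n⇒m<1+n 1<q))) 1≈0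
    ... | ()

  -- `q` represents -1 modulo `suc q`: explicitly, (r + 1)² = 1 + r(r + 2).
  q*q≈1 : q * q ≈ 1
  q*q≈1 = square q (ℕ.<-trans (s≤s z≤n) 1<q)
    where
    identity : ∀ r → suc r * suc r ≡ 1 + r * suc (suc r)
    identity = solve-∀

    square : ∀ n → 0 < n → (n * n) mod suc n ≡ 1 mod suc n
    square (suc r) _ = trans (cong (_% suc (suc r)) (identity r)) ([m+kn]%n≡m%n 1 r (suc (suc r)))

  -- Since −1 is a power of g, so is its square 1; this exhibits an inverse of g.
  g-invertible : ∃ λ h → h * g ≈ 1
  g-invertible with primitive-root q (ℕ.<⇒≤ 1<q) (ℕ.n<1+n q)
  ... | zero  , 1≡q = contradiction (trans (sym (m<n⇒m%n≡m (ℕ.m<n⇒m<1+n 1<q))) 1≡q) (ℕ.<⇒≢ 1<q)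
  ... | suc i , g^i≡q = g ^ suc i * g ^ i , (begin
    (g ^ suc i * g ^ i * g) mod p   ≡⟨ ≡⇒≈ (trans (ℕ.*-assoc (g ^ suc i) (g ^ i) g) (cong (g ^ suc i *_) (ℕ.*-comm (g ^ i) g))) ⟩
    (g ^ suc i * g ^ suc i) mod p   ≡⟨ *-cong-≈ {g ^ suc i} {q} {g ^ suc i} {q} g^i≈q g^i≈q ⟩
    (q * q) mod p                   ≡⟨ q*q≈1 ⟩
    1 mod p                         ∎)
    where
    g^i≈q : g ^ suc i ≈ q
    g^i≈q = trans g^i≡q (sym (m<n⇒m%n≡m (ℕ.n<1+n q)))

  *-cancelˡ-g : ∀ x y → g * x ≈ g * y → x ≈ y
  *-cancelˡ-g x y gx≈gy = trans (sym (undo x)) (trans (*-cong-≈ {h} {h} {g * x} {g * y} refl gx≈gy) (undo y))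
    where
    h = proj₁ g-invertible

    undo : ∀ z → h * (g * z) ≈ z
    undo z = begin
      (h * (g * z)) mod p ≡⟨ ≡⇒≈ (ℕ.*-assoc h g z) ⟨
      (h * g * z) mod p   ≡⟨ *-cong-≈ {h * g} {1} {z} {z} (proj₂ g-invertible) refl ⟩
      (1 * z) mod p       ≡⟨ ≡⇒≈ (ℕ.*-identityˡ z) ⟩
      z mod p             ∎

  *-cancelˡ-g^ : ∀ i x y → g ^ i * x ≈ g ^ i * y → x ≈ y
  *-cancelˡ-g^ zero    x y eq = trans (≡⇒≈ (sym (ℕ.*-identityˡ x))) (trans eq (≡⇒≈ (ℕ.*-identityˡ y)))
  *-cancelˡ-g^ (suc i) x y eq = *-cancelˡ-g^ i x y (*-cancelˡ-g (g ^ i * x) (g ^ i * y)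
    (trans (≡⇒≈ (sym (ℕ.*-assoc g (g ^ i) x))) (trans eq (≡⇒≈ (ℕ.*-assoc g (g ^ i) y)))))

  residue-0-g^ : ∀ i x → residue 0 (g ^ i * x) ≡ residue 0 x
  residue-0-g^ i x = ⟦⟧-cong ((g ^ i * x) mod p ℕ.≟ 0) (x mod p ℕ.≟ 0)
    (λ eq → *-cancelˡ-g^ i x 0 (trans eq (≡⇒≈ (sym (ℕ.*-zeroʳ (g ^ i))))))
    (λ eq → trans (*-cong-≈ {g ^ i} {g ^ i} {x} {0} refl eq) (≡⇒≈ (ℕ.*-zeroʳ (g ^ i))))

  g^≉0 : ∀ i → ¬ (g ^ i ≈ 0)
  g^≉0 i g^i≈0 = 1≉0 (*-cancelˡ-g^ i 1 0
    (trans (≡⇒≈ (ℕ.*-identityʳ (g ^ i))) (trans g^i≈0 (≡⇒≈ (sym (ℕ.*-zeroʳ (g ^ i)))))))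

  g^-*≈1 : ∀ t → g ^ t ≈ 1 → ∀ k → g ^ (k * t) ≈ 1
  g^-*≈1 t g^t≈1 zero    = refl
  g^-*≈1 t g^t≈1 (suc k) = trans (≡⇒≈ (ℕ.^-distribˡ-+-* g t (k * t)))
    (*-cong-≈ {g ^ t} {1} {g ^ (k * t)} {1} g^t≈1 (g^-*≈1 t g^t≈1 k))

  g^-% : ∀ t .{{_ : NonZero t}} → g ^ t ≈ 1 → ∀ i → g ^ i ≈ g ^ (i % t)
  g^-% t g^t≈1 i = begin
    (g ^ i) mod p                             ≡⟨ ≡⇒≈ (cong (g ^_) (m≡m%n+[m/n]*n i t)) ⟩
    (g ^ (i % t + i / t * t)) mod p           ≡⟨ ≡⇒≈ (ℕ.^-distribˡ-+-* g (i % t) (i / t * t)) ⟩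
    (g ^ (i % t) * g ^ (i / t * t)) mod p     ≡⟨ *-cong-≈ {g ^ (i % t)} {g ^ (i % t)} {g ^ (i / t * t)} {1} refl (g^-*≈1 t g^t≈1 (i / t)) ⟩
    (g ^ (i % t) * 1) mod p                   ≡⟨ ≡⇒≈ (ℕ.*-identityʳ (g ^ (i % t))) ⟩
    (g ^ (i % t)) mod p                       ∎

  -- The powers g^i with i < t exhaust the q nonzero residues.
  q≤period : ∀ t .{{_ : NonZero t}} → g ^ t ≈ 1 → q ≤ t
  q≤period t g^t≈1 = injective⇒≤ {f = log} log-injective
    where
    exponent : (a : Fin q) → ∃ λ i → (g ^ i) mod p ≡ suc (toℕ a)
    exponent a = primitive-root (suc (toℕ a)) (s≤s z≤n) (s≤s (toℕ<n a))

    log : Fin q → Fin t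
    log a = fromℕ< (m%n<n (proj₁ (exponent a)) t)

    log-injective : ∀ {a b} → log a ≡ log b → a ≡ b
    log-injective {a} {b} eq with exponent a | exponent b
    ... | i , g^i≡a | j , g^j≡b = toℕ-injective (ℕ.suc-injective (begin
      suc (toℕ a)         ≡⟨ g^i≡a ⟨
      (g ^ i) mod p       ≡⟨ g^-% t g^t≈1 i ⟩
      (g ^ (i % t)) mod p ≡⟨ ≡⇒≈ (cong (g ^_) (fromℕ<-injective (i % t) (j % t) (m%n<n i t) (m%n<n j t) eq)) ⟩
      (g ^ (j % t)) mod p ≡⟨ g^-% t g^t≈1 j ⟨
      (g ^ j) mod p       ≡⟨ g^j≡b ⟩
      suc (toℕ b)         ∎))

  -- The exponents 0, ..., q give only q possible nonzero residues, numbered from 0 by `pred`. Two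
  -- powers therefore agree, and cancelling the smaller one leaves a period.
  some-period : ∃ λ t → 0 < t × t ≤ q × g ^ t ≈ 1
  some-period with pigeonhole (ℕ.n<1+n q) (λ i → fromℕ< (power<q (toℕ i)))
    where
    power<q : ∀ i → pred ((g ^ i) mod p) < q
    power<q i with (g ^ i) mod p in eq | m%n<n (g ^ i) p
    ... | zero  | _         = contradiction eq (g^≉0 i)
    ... | suc r | s≤s r<q   = r<q
  ... | i , j , i<j , fi≡fj = toℕ j ∸ toℕ i , ℕ.m<n⇒0<n∸m i<j ,
          ℕ.≤-trans (ℕ.m∸n≤m (toℕ j) (toℕ i)) (ℕ.≤-pred (toℕ<n j)) , *-cancelˡ-g^ (toℕ i) _ 1 (begin
      (g ^ toℕ i * g ^ (toℕ j ∸ toℕ i)) mod p ≡⟨ ≡⇒≈ (ℕ.^-distribˡ-+-* g (toℕ i) (toℕ j ∸ toℕ i)) ⟨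
      (g ^ (toℕ i + (toℕ j ∸ toℕ i))) mod p   ≡⟨ ≡⇒≈ (cong (g ^_) (ℕ.m+[n∸m]≡n (ℕ.<⇒≤ i<j))) ⟩
      (g ^ toℕ j) mod p     ≡⟨ pred-injective (g^≉0 (toℕ i)) (g^≉0 (toℕ j)) (fromℕ<-injective _ _ _ _ fi≡fj) ⟨
      (g ^ toℕ i) mod p     ≡⟨ ≡⇒≈ (ℕ.*-identityʳ (g ^ toℕ i)) ⟨
      (g ^ toℕ i * 1) mod p ∎)
    where
    pred-injective : ∀ {a b} → a ≢ 0 → b ≢ 0 → pred a ≡ pred b → a ≡ b
    pred-injective {zero}          a≢0 _   _  = contradiction refl a≢0
    pred-injective {suc a} {zero}  _   b≢0 _  = contradiction refl b≢0
    pred-injective {suc a} {suc b} _   _   eq = cong suc eq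

  -- The pigeonhole gives a period of size at most `q`, and no positive period is smaller than `q`.
  fermat : g ^ q ≈ 1
  fermat with some-period
  ... | t , 0<t , t≤q , g^t≈1 =
    subst (λ n → g ^ n ≈ 1) (ℕ.≤-antisym t≤q (q≤period t {{>-nonZero 0<t}} g^t≈1)) g^t≈1

-- Cyclotomic classes, coefficients of the periods and Gauss symbols.

module Periods (q g n m : ℕ) (1<q : 1 < q) (q≡md : q ≡ m * suc n)
               (primitive-root : IsPrimitiveRoot (suc q) g) where

  open Residues q
  open PrimitiveRoot q g 1<q primitive-root

  private
    p d : ℕ
    p = suc q
    d = suc n

    C : ℕ → List ℕ
    C = cls p g d m

  ∑-cls : ∀ s φ → Periodic φ → ∑ (C s) φ ≡ ∑[ j ∈ upTo m ] φ (g ^ (j * d + s))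
  ∑-cls s φ φ-per = trans (∑-map (λ j → (g ^ (j * d + s)) mod p) (upTo m) φ)
                          (∑-cong (upTo m) (λ j → φ-per _ _ (mod-≈ (g ^ (j * d + s)))))

  -- Raising the index by `d` moves `j` to `j + 1`. The term at `j = m` coincides with that at
  -- `j = 0`, because `m * d = q` and g^q ≈ 1.
  ∑-cls-wrap : ∀ s φ → Periodic φ → ∑ (C (d + s)) φ ≡ ∑ (C s) φ
  ∑-cls-wrap s φ φ-per = begin
    ∑ (C (d + s)) φ                             ≡⟨ ∑-cls (d + s) φ φ-per ⟩
    ∑[ j ∈ upTo m ] φ (g ^ (j * d + (d + s)))   ≡⟨ ∑-cong (upTo m) (λ j → cong (φ ∘ (g ^_)) (exponents j)) ⟩
    ∑[ j ∈ upTo m ] φ (g ^ (suc j * d + s))     ≡⟨ ∑-upTo-rotate m (λ j → φ (g ^ (j * d + s))) (φ-per _ _ full-turn) ⟩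
    ∑[ j ∈ upTo m ] φ (g ^ (j * d + s))         ≡⟨ ∑-cls s φ φ-per ⟨
    ∑ (C s) φ                                   ∎
    where
    exponents : ∀ j → j * d + (d + s) ≡ suc j * d + s
    exponents j = trans (sym (ℕ.+-assoc (j * d) d s)) (cong (_+ s) (ℕ.+-comm (j * d) d))

    full-turn : g ^ (m * d + s) ≈ g ^ s
    full-turn = begin
      (g ^ (m * d + s)) mod p   ≡⟨ ≡⇒≈ (cong (λ e → g ^ (e + s)) q≡md) ⟨
      (g ^ (q + s)) mod p       ≡⟨ ≡⇒≈ (ℕ.^-distribˡ-+-* g q s) ⟩
      (g ^ q * g ^ s) mod p     ≡⟨ *-cong-≈ {g ^ q} {1} {g ^ s} {g ^ s} fermat refl ⟩
      (1 * g ^ s) mod p         ≡⟨ ≡⇒≈ (ℕ.*-identityˡ (g ^ s)) ⟩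
      (g ^ s) mod p             ∎

  Periodic-* : ∀ c φ → Periodic φ → Periodic (φ ∘ (c *_))
  Periodic-* c φ φ-per x y x≈y = φ-per _ _ (*-cong-≈ {c} {c} {x} {y} refl x≈y)

  Scaled-cls-suc : ∀ s → Scaled g (C s) (C (suc s))
  Scaled-cls-suc s = scaled λ φ φ-per → begin
    ∑[ x ∈ C s ] φ (g * x)                    ≡⟨ ∑-cls s (φ ∘ (g *_)) (Periodic-* g φ φ-per) ⟩
    ∑[ j ∈ upTo m ] φ (g ^ suc (j * d + s))   ≡⟨ ∑-cong (upTo m) (λ j → cong (φ ∘ (g ^_)) (ℕ.+-suc (j * d) s)) ⟨
    ∑[ j ∈ upTo m ] φ (g ^ (j * d + suc s))   ≡⟨ ∑-cls (suc s) φ φ-per ⟨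
    ∑ (C (suc s)) φ                           ∎

  Scaled-cls-last : Scaled g (C n) (C 0)
  Scaled-cls-last = scaled λ φ φ-per → begin
    ∑[ x ∈ C n ] φ (g * x) ≡⟨ ∑-scaled (Scaled-cls-suc n) φ φ-per ⟩
    ∑ (C d) φ              ≡⟨ cong (λ s → ∑ (C s) φ) (ℕ.+-identityʳ d) ⟨
    ∑ (C (d + 0)) φ        ≡⟨ ∑-cls-wrap 0 φ φ-per ⟩
    ∑ (C 0) φ              ∎

  Scaled-cls-g^d : ∀ s → Scaled (g ^ d) (C s) (C s)
  Scaled-cls-g^d s = scaled λ φ φ-per → begin
    ∑[ x ∈ C s ] φ (g ^ d * x)
      ≡⟨ ∑-cls s (φ ∘ (g ^ d *_)) (Periodic-* (g ^ d) φ φ-per) ⟩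
    ∑[ j ∈ upTo m ] φ (g ^ d * g ^ (j * d + s)) ≡⟨ ∑-cong (upTo m) (λ j → cong φ (exponents j)) ⟩
    ∑[ j ∈ upTo m ] φ (g ^ (j * d + (d + s)))   ≡⟨ ∑-cls (d + s) φ φ-per ⟨
    ∑ (C (d + s)) φ                             ≡⟨ ∑-cls-wrap s φ φ-per ⟩
    ∑ (C s) φ                                   ∎
    where
    exponents : ∀ j → g ^ d * g ^ (j * d + s) ≡ g ^ (j * d + (d + s))
    exponents j = trans (sym (ℕ.^-distribˡ-+-* g d (j * d + s))) (cong (g ^_) (+-xyz≈yxz d (j * d) s))

  Pointwise-cls-suc : ∀ ss → Pointwise (Scaled g) (map C ss) (map (C ∘ suc) ss)
  Pointwise-cls-suc []       = []
  Pointwise-cls-suc (s ∷ ss) = Scaled-cls-suc s ∷ Pointwise-cls-suc ss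

  Pointwise-cls-last : ∀ ss → Pointwise (Scaled g) (map C ss ∷ʳ C n) (map (C ∘ suc) ss ∷ʳ C 0)
  Pointwise-cls-last []       = Scaled-cls-last ∷ []
  Pointwise-cls-last (s ∷ ss) = Scaled-cls-suc s ∷ Pointwise-cls-last ss

  Pointwise-cls-g^d : ∀ ss → Pointwise (Scaled (g ^ d)) (map C ss) (map C ss)
  Pointwise-cls-g^d []       = []
  Pointwise-cls-g^d (s ∷ ss) = Scaled-cls-g^d s ∷ Pointwise-cls-g^d ss

  -- Multiplication by `g` turns the periods into C_1, ..., C_(d-1), C_0, and `∑-esym-∷ʳ` absorbs
  -- the cyclic reordering.
  Scaled-akFormal : ∀ k → Scaled g (akFormal p g d m k) (akFormal p g d m k)
  Scaled-akFormal k = scaled λ φ φ-per → begin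
    ∑[ x ∈ esym k (map C (upTo d)) ] φ (g * x)
      ≡⟨ cong (λ l → ∑[ x ∈ esym k l ] φ (g * x)) (trans (cong (map C) (sym (List.upTo-∷ʳ n))) (List.map-++ C (upTo n) (n ∷ []))) ⟩
    ∑[ x ∈ esym k (map C (upTo n) ∷ʳ C n) ] φ (g * x) ≡⟨ ∑-scaled (Scaled-esym k (Pointwise-cls-last (upTo n))) φ φ-per ⟩
    ∑ (esym k (map (C ∘ suc) (upTo n) ∷ʳ C 0)) φ      ≡⟨ ∑-esym-∷ʳ k (map (C ∘ suc) (upTo n)) (C 0) φ ⟩
    ∑ (esym k (C 0 ∷ map (C ∘ suc) (upTo n))) φ       ≡⟨ cong (λ l → ∑ (esym k l) φ) (map-upTo-suc C n) ⟨
    ∑ (esym k (map C (upTo d))) φ                     ∎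

  module _ {E : List ℕ} (E-invariant : Scaled g E E) where

    -- `E` may be replaced by its multiple by `g`, and since `g` is invertible, gx ≈ gr holds
    -- exactly when x ≈ r.
    coeff-g* : ∀ r → coeff p E ((g * r) mod p) ≡ coeff p E (r mod p)
    coeff-g* r = begin
      coeff p E ((g * r) mod p)                          ≡⟨ coeff-∑ E ((g * r) mod p) ⟩
      ∑ E (residue ((g * r) mod p))                      ≡⟨ ∑-scaled E-invariant (residue ((g * r) mod p)) (residue-periodic ((g * r) mod p)) ⟨
      ∑[ x ∈ E ] residue ((g * r) mod p) (g * x)
        ≡⟨ ∑-cong E (λ x → ⟦⟧-cong ((g * x) mod p ℕ.≟ (g * r) mod p) (x mod p ℕ.≟ r mod p) (*-cancelˡ-g x r) (*-cong-≈ {g} {g} {x} {r} refl)) ⟩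
      ∑ E (residue (r mod p))                            ≡⟨ coeff-∑ E (r mod p) ⟨
      coeff p E (r mod p)                                ∎

    coeff-g^ : ∀ i → coeff p E ((g ^ i) mod p) ≡ coeff p E (1 mod p)
    coeff-g^ zero    = refl
    coeff-g^ (suc i) = trans (coeff-g* (g ^ i)) (coeff-g^ i)

    coeff-nonzero : ∀ r → suc r < p → coeff p E (suc r) ≡ coeff p E (1 mod p)
    coeff-nonzero r r<p with primitive-root (suc r) (s≤s z≤n) r<p
    ... | i , g^i≡r = trans (cong (coeff p E) (sym g^i≡r)) (coeff-g^ i)

    length-coeff : length E ≡ coeff p E 0 + q * coeff p E (1 mod p)
    length-coeff = begin
      length E                        ≡⟨ ∑-coeff E ⟨
      ∑ (upTo p) (coeff p E)          ≡⟨ ∑-upTo-suc q (coeff p E) ⟩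
      coeff p E 0 + ∑ (upTo q) (coeff p E ∘ suc)
        ≡⟨ cong (coeff p E 0 +_) (∑-cong-∈ (upTo q) (λ r r∈ → coeff-nonzero r (s≤s (∈-upTo⁻ r∈)))) ⟩
      coeff p E 0 + (∑[ r ∈ upTo q ] coeff p E (1 mod p)) ≡⟨ cong (coeff p E 0 +_) (∑-const (upTo q) (coeff p E (1 mod p))) ⟩
      coeff p E 0 + length (upTo q) * coeff p E (1 mod p)
        ≡⟨ cong (λ l → coeff p E 0 + l * coeff p E (1 mod p)) (List.length-upTo q) ⟩
      coeff p E 0 + q * coeff p E (1 mod p) ∎

  gaussSymbol-∑ : ∀ Ms → gaussSymbol p Ms ≡ ∑ (allSums Ms) (residue 0)
  gaussSymbol-∑ Ms = length-filter (λ x → (x mod p) ℕ.≟ 0) (allSums Ms)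

  -- Multiplying a solution by a power of g^d moves its first component through C s and
  -- preserves the other classes.
  gaussSymbol-first : ∀ s ss → gaussSymbol p (map C (s ∷ ss)) ≡
                      m * gaussSymbol p (((g ^ s) mod p ∷ []) ∷ map C ss)
  gaussSymbol-first s ss = begin
    gaussSymbol p (map C (s ∷ ss))          ≡⟨ gaussSymbol-∑ (map C (s ∷ ss)) ⟩
    ∑ (mulF (C s) rest) (residue 0)         ≡⟨ ∑-mulF (C s) rest (residue 0) ⟩
    ∑ (C s) solutions                       ≡⟨ ∑-cls s solutions solutions-periodic ⟩
    ∑[ j ∈ upTo m ] solutions (g ^ (j * d + s)) ≡⟨ ∑-cong (upTo m) solutions-j ⟩
    ∑[ j ∈ upTo m ] solutions ((g ^ s) mod p)   ≡⟨ ∑-const (upTo m) (solutions ((g ^ s) mod p)) ⟩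
    length (upTo m) * solutions ((g ^ s) mod p) ≡⟨ cong₂ _*_ (List.length-upTo m) first ⟩
    m * gaussSymbol p (((g ^ s) mod p ∷ []) ∷ map C ss) ∎
    where
    rest : List ℕ
    rest = allSums (map C ss)

    solutions : ℕ → ℕ
    solutions a = ∑[ y ∈ rest ] residue 0 (a + y)

    solutions-periodic : Periodic solutions
    solutions-periodic a b a≈b =
      ∑-cong rest (λ y → residue-periodic 0 (a + y) (b + y) (+-cong-≈ {a} {b} {y} {y} a≈b refl))

    solutions-g^d : ∀ a → solutions (g ^ d * a) ≡ solutions a
    solutions-g^d a = begin
      ∑[ y ∈ rest ] residue 0 (g ^ d * a + y)
        ≡⟨ ∑-scaled (Scaled-allSums (Pointwise-cls-g^d ss)) (λ y → residue 0 (g ^ d * a + y))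
             (λ y z y≈z → residue-periodic 0 (g ^ d * a + y) (g ^ d * a + z) (+-cong-≈ {g ^ d * a} {g ^ d * a} {y} {z} refl y≈z)) ⟨
      ∑[ y ∈ rest ] residue 0 (g ^ d * a + g ^ d * y)
        ≡⟨ ∑-cong rest (λ y → cong (residue 0) (ℕ.*-distribˡ-+ (g ^ d) a y)) ⟨
      ∑[ y ∈ rest ] residue 0 (g ^ d * (a + y)) ≡⟨ ∑-cong rest (λ y → residue-0-g^ d (a + y)) ⟩
      ∑[ y ∈ rest ] residue 0 (a + y)           ∎

    solutions-j : ∀ j → solutions (g ^ (j * d + s)) ≡ solutions ((g ^ s) mod p)
    solutions-j zero    = solutions-periodic (g ^ s) ((g ^ s) mod p) (sym (mod-≈ (g ^ s)))
    solutions-j (suc j) = begin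
      solutions (g ^ (suc j * d + s))      ≡⟨ cong (solutions ∘ (g ^_)) (ℕ.+-assoc d (j * d) s) ⟩
      solutions (g ^ (d + (j * d + s)))    ≡⟨ cong solutions (ℕ.^-distribˡ-+-* g d (j * d + s)) ⟩
      solutions (g ^ d * g ^ (j * d + s))  ≡⟨ solutions-g^d (g ^ (j * d + s)) ⟩
      solutions (g ^ (j * d + s))          ≡⟨ solutions-j j ⟩
      solutions ((g ^ s) mod p)            ∎

    first : solutions ((g ^ s) mod p) ≡ gaussSymbol p (((g ^ s) mod p ∷ []) ∷ map C ss)
    first = sym (begin
      gaussSymbol p (((g ^ s) mod p ∷ []) ∷ map C ss)     ≡⟨ gaussSymbol-∑ (((g ^ s) mod p ∷ []) ∷ map C ss) ⟩
      ∑ (mulF ((g ^ s) mod p ∷ []) rest) (residue 0) ≡⟨ ∑-mulF ((g ^ s) mod p ∷ []) rest (residue 0) ⟩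
      solutions ((g ^ s) mod p) + 0                  ≡⟨ ℕ.+-identityʳ _ ⟩
      solutions ((g ^ s) mod p)                      ∎)

  gaussSymbol-scaled : ∀ {Ms Ns} → Pointwise (Scaled g) Ms Ns → gaussSymbol p Ms ≡ gaussSymbol p Ns
  gaussSymbol-scaled {Ms} {Ns} rs = begin
    gaussSymbol p Ms              ≡⟨ gaussSymbol-∑ Ms ⟩
    ∑ (allSums Ms) (residue 0)
      ≡⟨ ∑-cong (allSums Ms) (λ x → trans (cong (λ c → residue 0 (c * x)) (sym (ℕ.^-identityʳ g))) (residue-0-g^ 1 x)) ⟨
    ∑[ x ∈ allSums Ms ] residue 0 (g * x) ≡⟨ ∑-scaled (Scaled-allSums rs) (residue 0) (residue-periodic 0) ⟩
    ∑ (allSums Ns) (residue 0)    ≡⟨ gaussSymbol-∑ Ns ⟨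
    gaussSymbol p Ns              ∎

  -- If the last index `n` is absent from `S`, every class index rises by one. If it is present, its
  -- class becomes C_0, which `elems (shift1 S)` lists first although it comes from the last class,
  -- so the classes are also reordered.
  gaussSymbol-shift1 : (S : Subset d) →
                       gaussSymbol p (map C (elems (shift1 S))) ≡ gaussSymbol p (map C (elems S))
  gaussSymbol-shift1 S with initLast S
  ... | S′ , false , refl = begin
    gaussSymbol p (map C (map suc (elems S′)))  ≡⟨ cong (gaussSymbol p) (List.map-∘ (elems S′)) ⟨
    gaussSymbol p (map (C ∘ suc) (elems S′))    ≡⟨ gaussSymbol-scaled (Pointwise-cls-suc (elems S′)) ⟨
    gaussSymbol p (map C (elems S′))            ≡⟨ cong (gaussSymbol p ∘ map C) (elems-∷ʳ-false S′) ⟨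
    gaussSymbol p (map C (elems (S′ Vec.∷ʳ false))) ∎
  ... | S′ , true  , refl = begin
    gaussSymbol p (C 0 ∷ map C (map suc (elems S′))) ≡⟨ cong (λ l → gaussSymbol p (C 0 ∷ l)) (List.map-∘ (elems S′)) ⟨
    gaussSymbol p (C 0 ∷ C′s)                   ≡⟨ gaussSymbol-∑ (C 0 ∷ C′s) ⟩
    ∑ (allSums (C 0 ∷ C′s)) (residue 0)         ≡⟨ ∑-allSums-∷ʳ C′s (C 0) (residue 0) ⟨
    ∑ (allSums (C′s ∷ʳ C 0)) (residue 0)        ≡⟨ gaussSymbol-∑ (C′s ∷ʳ C 0) ⟨
    gaussSymbol p (C′s ∷ʳ C 0)                  ≡⟨ gaussSymbol-scaled (Pointwise-cls-last (elems S′)) ⟨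
    gaussSymbol p (map C (elems S′) ∷ʳ C n)     ≡⟨ cong (gaussSymbol p) (List.map-++ C (elems S′) (n ∷ [])) ⟨
    gaussSymbol p (map C (elems S′ ∷ʳ n))       ≡⟨ cong (gaussSymbol p ∘ map C) (elems-∷ʳ-true S′) ⟨
    gaussSymbol p (map C (elems (S′ Vec.∷ʳ true))) ∎
    where
    C′s : List (List ℕ)
    C′s = map (C ∘ suc) (elems S′)

  m*zS : (S : Subset d) → 1 ≤ ∣ S ∣ → m * zS p g d m S ≡ gaussSymbol p (map C (elems S))
  m*zS S 1≤∣S∣ with elems S | length-elems S
  ... | []     | 0≡∣S∣ = contradiction 1≤∣S∣ (ℕ.≤⇒≯ (ℕ.≤-reflexive (sym 0≡∣S∣)))
  ... | s ∷ ss | _     = sym (gaussSymbol-first s ss)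

  instance
    m≢0 : NonZero m
    m≢0 = >-nonZero (ℕ.n≢0⇒n>0 (λ m≡0 → contradiction (trans q≡md (cong (_* d) m≡0)) (ℕ.<⇒≢ (ℕ.<-trans (s≤s z≤n) 1<q) ∘ sym)))

  -- The full symbol treats all classes alike, whatever class supplies the fixed element of `zS`;
  -- hence the comparison is made after multiplying by `m`.
  zS-shift1 : (S : Subset d) → 1 ≤ ∣ S ∣ → zS p g d m (shift1 S) ≡ zS p g d m S
  zS-shift1 S 1≤∣S∣ = ℕ.*-cancelˡ-≡ _ _ m (begin
    m * zS p g d m (shift1 S)                 ≡⟨ m*zS (shift1 S) (subst (1 ≤_) (sym (∣shift1∣ S)) 1≤∣S∣) ⟩
    gaussSymbol p (map C (elems (shift1 S)))  ≡⟨ gaussSymbol-shift1 S ⟩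
    gaussSymbol p (map C (elems S))           ≡⟨ m*zS S 1≤∣S∣ ⟨
    m * zS p g d m S                          ∎)

  zS-rotations : ∀ i (S : Subset d) → 1 ≤ ∣ S ∣ → zS p g d m (rotations i S) ≡ zS p g d m S
  zS-rotations zero    S 1≤∣S∣ = refl
  zS-rotations (suc i) S 1≤∣S∣ =
    trans (zS-shift1 (rotations i S) (subst (1 ≤_) (sym (∣rotations∣ i S)) 1≤∣S∣)) (zS-rotations i S 1≤∣S∣)

  zS-SameOrbit : ∀ {S R : Subset d} → 1 ≤ ∣ S ∣ → SameOrbit S R → zS p g d m S ≡ zS p g d m R
  zS-SameOrbit {S} 1≤∣S∣ S~R with SameOrbit⇒rotations S~R
  ... | i , _ , refl = sym (zS-rotations i S 1≤∣S∣)

  coeff-0-akFormal : ∀ k → 1 ≤ k → coeff p (akFormal p g d m k) 0 ≡ m * ∑ (subsets d k) (zS p g d m)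
  coeff-0-akFormal k 1≤k = begin
    coeff p (akFormal p g d m k) 0             ≡⟨ coeff-∑ (akFormal p g d m k) 0 ⟩
    ∑ (akFormal p g d m k) (residue 0)         ≡⟨ ∑-esym-subsets d k C (residue 0) ⟩
    ∑[ S ∈ subsets d k ] ∑ (allSums (map C (elems S))) (residue 0) ≡⟨ ∑-cong-∈ (subsets d k) (λ S S∈ →
      trans (sym (gaussSymbol-∑ (map C (elems S)))) (sym (m*zS S (subst (1 ≤_) (sym (∈-subsets⇒∣∣ d k S∈)) 1≤k)))) ⟩
    ∑[ S ∈ subsets d k ] (m * zS p g d m S)    ≡⟨ ∑-*ˡ (subsets d k) m (zS p g d m) ⟩
    m * ∑ (subsets d k) (zS p g d m)           ∎

  ∑-1-allSums : ∀ ss → ∑[ x ∈ allSums (map C ss) ] 1 ≡ m ^ length ss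
  ∑-1-allSums []       = refl
  ∑-1-allSums (s ∷ ss) = begin
    ∑[ x ∈ allSums (map C (s ∷ ss)) ] 1            ≡⟨ ∑-mulF (C s) (allSums (map C ss)) (λ _ → 1) ⟩
    ∑[ x ∈ C s ] ∑[ y ∈ allSums (map C ss) ] 1     ≡⟨ ∑-cong (C s) (λ _ → ∑-1-allSums ss) ⟩
    ∑[ x ∈ C s ] m ^ length ss                     ≡⟨ ∑-const (C s) (m ^ length ss) ⟩
    length (C s) * m ^ length ss
      ≡⟨ cong (_* m ^ length ss) (trans (List.length-map (λ j → (g ^ (j * d + s)) mod p) (upTo m)) (List.length-upTo m)) ⟩
    m * m ^ length ss                              ∎

  length-akFormal : ∀ k → length (akFormal p g d m k) ≡ length (subsets d k) * m ^ k
  length-akFormal k = begin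
    length E                         ≡⟨ ℕ.*-identityʳ (length E) ⟨
    length E * 1                     ≡⟨ ∑-const E 1 ⟨
    ∑[ x ∈ E ] 1                     ≡⟨ ∑-esym-subsets d k C (λ _ → 1) ⟩
    ∑[ S ∈ subsets d k ] ∑[ x ∈ allSums (map C (elems S)) ] 1 ≡⟨ ∑-cong-∈ (subsets d k) (λ S S∈ →
      trans (∑-1-allSums (elems S)) (cong (m ^_) (trans (length-elems S) (∈-subsets⇒∣∣ d k S∈)))) ⟩
    ∑[ S ∈ subsets d k ] m ^ k       ≡⟨ ∑-const (subsets d k) (m ^ k) ⟩
    length (subsets d k) * m ^ k     ∎
    where E = akFormal p g d m k

∑-1 : {A : Set} (xs : List A) → ∑[ x ∈ xs ] 1 ≡ length xs
∑-1 xs = trans (∑-const xs 1) (ℕ.*-identityʳ (length xs))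

open import Data.Integer using (ℤ; +_; 0ℤ)

-- The right-hand side over the common denominator d.

/-cross : ∀ a b i n → a ℤ.* + suc n ≡ b ℤ.* + suc i → a ℚ./ suc i ≡ b ℚ./ suc n
/-cross a b i n eq = ℚ.fromℚᵘ-cong {mkℚᵘ a i} {mkℚᵘ b n} (*≡* eq)

/-+ : ∀ a b n → a ℚ./ suc n ℚ.+ b ℚ./ suc n ≡ (a ℤ.+ b) ℚ./ suc n
/-+ a b n = ℚ.toℚᵘ-injective (ℚᵘ.≃-trans (ℚ.toℚᵘ-homo-+ (a ℚ./ suc n) (b ℚ./ suc n))
  (ℚᵘ.≃-trans (ℚᵘ.+-cong (ℚ.toℚᵘ-fromℚᵘ (mkℚᵘ a n)) (ℚ.toℚᵘ-fromℚᵘ (mkℚᵘ b n)))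
  (ℚᵘ.≃-trans (*≡* (common-denominator a b (+ suc n))) (ℚᵘ.≃-sym (ℚ.toℚᵘ-fromℚᵘ (mkℚᵘ (a ℤ.+ b) n))))))
  where
  common-denominator : ∀ a b c → (a ℤ.* c ℤ.+ b ℤ.* c) ℤ.* c ≡ (a ℤ.+ b) ℤ.* (c ℤ.* c)
  common-denominator = ℤ-solve-∀

module CommonDenominator (p g n m k : ℕ) (T : ℕ → List (Subset (suc n))) where

  private
    d : ℕ
    d = suc n

    w Z N : ℕ → ℕ
    w i = cofactor d k i
    Z i = ∑ (T (suc i)) (zS p g d m)
    N i = length (T (suc i))

    M : ℕ
    M = m ^ (k ∸ 1)

  -- The bracket of the formula as a function of a sum `z` of Gauss symbols and a number `u` of
  -- subsets. It is linear in the pair (z, u), so weighted brackets add up to a single one.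
  numerator : ℕ → ℕ → ℤ
  numerator z u = + (p * z) ℤ.- + (u * M)

  -- 1/e = (d/e)/d, with the integer d/e supplied by `cofactor`; where e does not divide the gcd,
  -- both sides are 0.
  rhsTerm-cofactor : ∀ i → rhsTerm p g d m k T i ≡ (+ w i ℤ.* numerator (Z i) (N i)) ℚ./ d
  rhsTerm-cofactor i with suc i ∣? gcd d k
  ... | no _      = /-cross 0ℤ 0ℤ 0 n refl
  ... | yes e∣gcd = /-cross X (+ v ℤ.* X) i n (begin
    X ℤ.* + d                 ≡⟨ cong (λ c → X ℤ.* + c) (_∣_.equality e∣d) ⟩
    X ℤ.* + (v * suc i)       ≡⟨ cong (X ℤ.*_) (ℤ.pos-* v (suc i)) ⟩
    X ℤ.* (+ v ℤ.* + suc i)   ≡⟨ regroup X (+ v) (+ suc i) ⟩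
    + v ℤ.* X ℤ.* + suc i     ∎)
    where
    e∣d : suc i ∣ d
    e∣d = ∣-trans e∣gcd (gcd[m,n]∣m d k)

    v : ℕ
    v = quotient e∣d

    X : ℤ
    X = numerator (Z i) (N i)

    regroup : ∀ x y z → x ℤ.* (y ℤ.* z) ≡ y ℤ.* x ℤ.* z
    regroup = ℤ-solve-∀

  numerator-+ : ∀ v z u z′ u′ →
    + v ℤ.* numerator z u ℤ.+ numerator z′ u′ ≡ numerator (v * z + z′) (v * u + u′)
  numerator-+ v z u z′ u′ = begin
    + v ℤ.* numerator z u ℤ.+ numerator z′ u′
      ≡⟨ cong₂ (λ x y → + v ℤ.* x ℤ.+ y) (cast z u) (cast z′ u′) ⟩
    + v ℤ.* (+ p ℤ.* + z ℤ.- + u ℤ.* + M) ℤ.+ (+ p ℤ.* + z′ ℤ.- + u′ ℤ.* + M)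
      ≡⟨ regroup (+ v) (+ p) (+ z) (+ u) (+ M) (+ z′) (+ u′) ⟩
    + p ℤ.* (+ v ℤ.* + z ℤ.+ + z′) ℤ.- (+ v ℤ.* + u ℤ.+ + u′) ℤ.* + M
      ≡⟨ cong₂ (λ x y → + p ℤ.* x ℤ.- y ℤ.* + M) (affine z z′) (affine u u′) ⟨
    + p ℤ.* + (v * z + z′) ℤ.- + (v * u + u′) ℤ.* + M ≡⟨ cast (v * z + z′) (v * u + u′) ⟨
    numerator (v * z + z′) (v * u + u′) ∎
    where
    cast : ∀ z u → numerator z u ≡ + p ℤ.* + z ℤ.- + u ℤ.* + M
    cast z u = cong₂ ℤ._-_ (ℤ.pos-* p z) (ℤ.pos-* u M)

    affine : ∀ z z′ → + (v * z + z′) ≡ + v ℤ.* + z ℤ.+ + z′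
    affine z z′ = trans (ℤ.pos-+ (v * z) z′) (cong (ℤ._+ + z′) (ℤ.pos-* v z))

    regroup : ∀ v p z u M z′ u′ → v ℤ.* (p ℤ.* z ℤ.- u ℤ.* M) ℤ.+ (p ℤ.* z′ ℤ.- u′ ℤ.* M) ≡
              p ℤ.* (v ℤ.* z ℤ.+ z′) ℤ.- (v ℤ.* u ℤ.+ u′) ℤ.* M
    regroup = ℤ-solve-∀

  ∑-rhsTerm : ∀ is → foldr ℚ._+_ 0ℚ (map (rhsTerm p g d m k T) is) ≡
              numerator (∑[ i ∈ is ] (w i * Z i)) (∑[ i ∈ is ] (w i * N i)) ℚ./ d
  ∑-rhsTerm []       = /-cross 0ℤ (numerator 0 0) 0 n
    (sym (trans (ℤ.*-identityʳ (numerator 0 0)) (cong (λ x → + x ℤ.- 0ℤ) (ℕ.*-zeroʳ p))))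
  ∑-rhsTerm (i ∷ is) = begin
    rhsTerm p g d m k T i ℚ.+ foldr ℚ._+_ 0ℚ (map (rhsTerm p g d m k T) is)
      ≡⟨ cong₂ ℚ._+_ (rhsTerm-cofactor i) (∑-rhsTerm is) ⟩
    (+ w i ℤ.* numerator (Z i) (N i)) ℚ./ d ℚ.+ numerator z u ℚ./ d
      ≡⟨ /-+ (+ w i ℤ.* numerator (Z i) (N i)) (numerator z u) n ⟩
    (+ w i ℤ.* numerator (Z i) (N i) ℤ.+ numerator z u) ℚ./ d
      ≡⟨ cong (ℚ._/ d) (numerator-+ (w i) (Z i) (N i) z u) ⟩
    numerator (w i * Z i + z) (w i * N i + u) ℚ./ d ∎
    where
    z u : ℕ
    z = ∑[ i ∈ is ] (w i * Z i)
    u = ∑[ i ∈ is ] (w i * N i)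

  rhs-subsets : (∀ e → e ∣ gcd d k → IsTransversal d k e (T e)) →
                (∀ {S R} → ∣ S ∣ ≡ k → SameOrbit S R → zS p g d m S ≡ zS p g d m R) →
                rhs p g d m k T ≡ numerator (∑ (subsets d k) (zS p g d m)) (length (subsets d k)) ℚ./ d
  rhs-subsets transversal zS-invariant = trans (∑-rhsTerm (upTo d)) (cong₂ (λ z u → numerator z u ℚ./ d)
    (sym (∑-subsets (s≤s z≤n) transversal zS-invariant))
    (sym (begin
      length (subsets d k)      ≡⟨ ∑-1 (subsets d k) ⟨
      ∑[ S ∈ subsets d k ] 1    ≡⟨ ∑-subsets (s≤s z≤n) transversal (λ _ _ → refl) ⟩
      ∑[ i ∈ upTo d ] (w i * (∑[ R ∈ T (suc i) ] 1)) ≡⟨ ∑-cong (upTo d) (λ i → cong (w i *_) (∑-1 (T (suc i)))) ⟩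
      ∑[ i ∈ upTo d ] (w i * N i) ∎)))

difference-of-coefficients : ∀ q m .{{_ : NonZero m}} d N₀ c z u M → q ≡ m * d → N₀ ≡ m * z → N₀ + q * c ≡ u * (m * M) →
  (+ N₀ ℤ.- + c) ℤ.* + d ≡ + (suc q * z) ℤ.- + (u * M)
-- After multiplication by `m` the left side is q(N₀ - c) = (1 + q)N₀ - (N₀ + qc). The hypotheses
-- turn this into (1 + q)mz - umM, from which `m` cancels again.
difference-of-coefficients q m@(suc _) d N₀ c z u M refl refl total = ℤ.*-cancelˡ-≡ (+ m) _ _ (begin
  + m ℤ.* ((+ N₀ ℤ.- + c) ℤ.* + d) ≡⟨ complete (+ m) (+ N₀) (+ c) (+ d) ⟩
  (+ N₀ ℤ.+ + m ℤ.* + d ℤ.* + N₀) ℤ.- (+ N₀ ℤ.+ + m ℤ.* + d ℤ.* + c)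
    ≡⟨ cong (λ x → (+ N₀ ℤ.+ + m ℤ.* + d ℤ.* + N₀) ℤ.- x) total′ ⟩
  (+ N₀ ℤ.+ + m ℤ.* + d ℤ.* + N₀) ℤ.- + u ℤ.* (+ m ℤ.* + M)
    ≡⟨ cong (λ x → (x ℤ.+ + m ℤ.* + d ℤ.* x) ℤ.- + u ℤ.* (+ m ℤ.* + M)) (ℤ.pos-* m z) ⟩
  (+ m ℤ.* + z ℤ.+ + m ℤ.* + d ℤ.* (+ m ℤ.* + z)) ℤ.- + u ℤ.* (+ m ℤ.* + M)
    ≡⟨ factor (+ m) (+ z) (+ d) (+ u) (+ M) ⟩
  + m ℤ.* ((+ z ℤ.+ + m ℤ.* + d ℤ.* + z) ℤ.- + u ℤ.* + M) ≡⟨ cong (+ m ℤ.*_) (cong₂ ℤ._-_ p*z (ℤ.pos-* u M)) ⟨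
  + m ℤ.* (+ (suc q * z) ℤ.- + (u * M)) ∎)
  where
  complete : ∀ m N c d → m ℤ.* ((N ℤ.- c) ℤ.* d) ≡ (N ℤ.+ m ℤ.* d ℤ.* N) ℤ.- (N ℤ.+ m ℤ.* d ℤ.* c)
  complete = ℤ-solve-∀

  factor : ∀ m z d u M → (m ℤ.* z ℤ.+ m ℤ.* d ℤ.* (m ℤ.* z)) ℤ.- u ℤ.* (m ℤ.* M) ≡
           m ℤ.* ((z ℤ.+ m ℤ.* d ℤ.* z) ℤ.- u ℤ.* M)
  factor = ℤ-solve-∀

  cast : ∀ x y → + (x + q * y) ≡ + x ℤ.+ + m ℤ.* + d ℤ.* + y
  cast x y = trans (ℤ.pos-+ x (q * y)) (cong (ℤ._+_ (+ x)) (trans (ℤ.pos-* q y) (cong (ℤ._* + y) (ℤ.pos-* m d))))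

  p*z : + (suc q * z) ≡ + z ℤ.+ + m ℤ.* + d ℤ.* + z
  p*z = cast z z

  total′ : + N₀ ℤ.+ + m ℤ.* + d ℤ.* + c ≡ + u ℤ.* (+ m ℤ.* + M)
  total′ = trans (sym (cast N₀ c)) (trans (cong +_ total) (trans (ℤ.pos-* u (m * M)) (cong (+ u ℤ.*_) (ℤ.pos-* m M))))

theorem1 : (p d m k g : ℕ) → Prime p → ¬ (2 ∣ p) → 2 ≤ d → d ∣ p ∸ 1 → p ∸ 1 ≡ m * d
    → 1 ≤ k → k ≤ d → IsPrimitiveRoot p g
    → (T : ℕ → List (Subset d)) → (∀ e → e ∣ gcd d k → IsTransversal d k e (T e))
    → HasValue p (akFormal p g d m k) (rhs p g d m k T)
theorem1 zero _ _ _ _ p-prime = contradiction p-prime ¬prime[0]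
theorem1 (suc zero) _ _ _ _ p-prime = contradiction p-prime ¬prime[1]
theorem1 (suc (suc zero)) _ _ _ _ _ p-odd = contradiction ∣-refl p-odd
-- With `k` a successor, `m ^ k` unfolds to `m * m ^ (k ∸ 1)`, the form of the total required by
-- `difference-of-coefficients`.
theorem1 p@(suc q@(suc (suc _))) d@(suc n) m k@(suc _) g _ _ _ _ q≡md 1≤k _ primitive-root T transversal =
  -- The witness is the coefficient shared by all nonzero residues; subtracting it everywhere
  -- removes a multiple of 1 + ζ + ... + ζ^(p-1) = 0.
  + c , value
  where
  open Periods q g n m (s≤s (s≤s z≤n)) q≡md primitive-root
  open CommonDenominator p g n m k T

  E : List ℕ
  E = akFormal p g d m k

  c z u : ℕ
  c = coeff p E (1 mod p)
  z = ∑ (subsets d k) (zS p g d m)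
  u = length (subsets d k)

  constant-coefficient : (+ coeff p E 0 ℤ.- + c) ℤ.* + d ≡ numerator z u
  constant-coefficient = difference-of-coefficients q m d (coeff p E 0) c z u (m ^ (k ∸ 1)) q≡md (coeff-0-akFormal k 1≤k)
    (trans (sym (length-coeff (Scaled-akFormal k))) (length-akFormal k))

  value : ∀ r → r < p →
          ((+ coeff p E r ℤ.- + c) ℚ./ 1) ≡ (if r ≡ᵇ 0 then rhs p g d m k T else 0ℚ)
  value zero    _   = trans
    (/-cross (+ coeff p E 0 ℤ.- + c) (numerator z u) 0 n
      (trans constant-coefficient (sym (ℤ.*-identityʳ _))))
    (sym (rhs-subsets transversal (λ ∣S∣≡k → zS-SameOrbit (subst (1 ≤_) (sym ∣S∣≡k) 1≤k))))
  value (suc r) r<p = cong (ℚ._/ 1) (trans (cong (λ x → + x ℤ.- + c) (coeff-nonzero (Scaled-akFormal k) r r<p))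
                                           (ℤ.+-inverseʳ (+ c)))
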